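{- The skeleton dimension is incomparable to both highway dimensions $hd_1$ and $hd_2$. That is, for each $p\in\{hd_1,hd_2\}$, neither of $p$ and the skeleton dimension $\kappa$ is bounded by a function of the other on the class of weighted graphs.
   Context: Graphs $G=(V,E)$ are finite, simple, undirected and connected, with edge weights $\ell\colon E\to\mathbb{Q}^+$; $\mathrm{dist}(u,v)$ is the shortest path distance, and the shortest path between any two nodes is assumed to be unique. $B_r(u)=\{v\in V:\mathrm{dist}(u,v)\le r\}$, and $|\pi|$ is the length (total weight) of a path $\pi$. A hitting set for a set of paths is a set of nodes containing at least one node of each path; a path intersects a ball if it contains a node of it. Parameters $p,q$ are incomparable if there is no function $f\colon\mathbb{N}\to\mathbb{N}$ with $p(G)\le f(q(G))$ for all $G$ and no function $g\colon\mathbb{N}\to\mathbb{N}$ with $q(G)\le g(p(G))$ for all $G$. Geometric realization: $\tilde G=(\tilde V,\tilde E)$ is the continuous version of $G$ in which every edge $\{u,v\}$ is replaced by a segment of length $\ell(\{u,v\})$; thus $V\subseteq\tilde V$, distances between nodes of $V$ are unchanged, and for every edge $\{u,v\}$ and $0\le\alpha\le\ell(\{u,v\})$ there is a point $w\in\tilde V$ on it with $\mathrm{dist}(u,w)=\alpha$ and $\mathrm{dist}(w,v)=\ell(\{u,v\})-\alpha$. Skeleton dimension: for $s\in V$ let $T_s$ be the shortest path tree of $s$ and $\tilde T_s$ its geometric realization. The skeleton $T_s^*$ is the subtree of $\tilde T_s$ induced by all points $v$ that have a descendant $w$ in $\tilde T_s$ (rooted at $s$) with $\mathrm{dist}(v,w)\ge\frac12\mathrm{dist}(s,v)$.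 For $r\ge 0$, $\mathrm{Cut}_s^r$ is the set of all points $u$ of $T_s^*$ with $\mathrm{dist}(s,u)=r$. The skeleton dimension of $G$ is $\kappa=\max_{s,r}|\mathrm{Cut}_s^r|$. $hd_1$ is the smallest integer such that for any radius $r>0$ and any node $u$ there is a hitting set $S\subseteq B_{4r}(u)$ of size at most $hd_1$ for the set of all shortest paths $\pi$ with $|\pi|>r$ and $\pi\subseteq B_{4r}(u)$. $hd_2$ is the smallest integer such that for any radius $r>0$ and any node $u$ there is a hitting set $S\subseteq V$ of size at most $hd_2$ for the set of all shortest paths $\pi$ with $2r\ge|\pi|>r$ that intersect $B_{2r}(u)$. -}

module Defs where

open import Data.Fin.Base using (Fin)
open import Data.Integer.Base using (+_)
open import Data.List.Base as List using (List; []; _∷_)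
open import Data.List.Membership.Propositional using (_∈_)
open import Data.List.Relation.Unary.All using (All)
open import Data.List.Relation.Unary.AllPairs using (AllPairs)
open import Data.List.Relation.Unary.Any using (Any)
open import Data.Nat.Base as ℕ using (ℕ; NonZero)
open import Data.Product.Base using (_×_; _,_; ∃; Σ-syntax; ∃-syntax)
open import Data.Rational.Base using (ℚ; 0ℚ; ½; _/_; _+_; _-_; _*_; _≤_; _<_; ∣_∣)
open import Data.Sum.Base using (_⊎_; inj₁; inj₂; swap)
open import Function.Bundles using (_↔_)
open import Relation.Binary.PropositionalEquality using (_≡_)
open import Relation.Nullary using (¬_; Dec)

-- Finite simple undirected graphs with positive rational edge weights.
-- The value of ℓ on non-adjacent pairs is never used.

record WeightedGraph : Set₁ where
  field
    V        : Set
    order    : ℕ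
    finite   : V ↔ Fin order
    Adj      : V → V → Set
    irrefl   : ∀ {u} → ¬ Adj u u
    adj-sym  : ∀ {u v} → Adj u v → Adj v u
    ℓ        : V → V → ℚ
    ℓ-sym    : ∀ {u v} → Adj u v → ℓ u v ≡ ℓ v u
    ℓ-pos    : ∀ {u v} → Adj u v → 0ℚ < ℓ u v

module Paths (H : WeightedGraph) where
  open WeightedGraph H

  -- Nodes may repeat. As all weights are positive, a path of minimum length
  -- between its endpoints never repeats a node, so this affects neither
  -- distances nor shortest paths.
  data Path : V → V → Set where
    []  : ∀ {u} → Path u u
    _∷_ : ∀ {u v w} → Adj u v → Path v w → Path u w

  nodes : ∀ {u v} → Path u v → List V
  nodes {u} []      = u ∷ []
  nodes {u} (_ ∷ π) = u ∷ nodes π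

  ∥_∥ : ∀ {u v} → Path u v → ℚ
  ∥ [] ∥                  = 0ℚ
  ∥ _∷_ {u} {v} _ π ∥ = ℓ u v + ∥ π ∥

  IsShortest : ∀ {u v} → Path u v → Set
  IsShortest {u} {v} π = ∀ (σ : Path u v) → ∥ π ∥ ≤ ∥ σ ∥

  -- dist(u,v) = d
  IsDist : V → V → ℚ → Set
  IsDist u v d = Σ[ π ∈ Path u v ] IsShortest π × ∥ π ∥ ≡ d

  -- v ∈ B_r(u)
  InBall : ℚ → V → V → Set
  InBall r u v = ∃[ d ] IsDist u v d × d ≤ r

  -- x and y are consecutive, in this order, on the path.
  data Step (x y : V) : ∀ {u v} → Path u v → Set where
    here  : ∀ {w} {e : Adj x y} {π : Path y w} → Step x y (e ∷ π)
    there : ∀ {u v w} {e : Adj u v} {π : Path v w} → Step x y π → Step x y (e ∷ π)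

  step⇒adj : ∀ {x y u v} {π : Path u v} → Step x y π → Adj x y
  step⇒adj (here {e = e}) = e
  step⇒adj (there p)      = step⇒adj p

record Graph : Set₁ where
  field
    weighted : WeightedGraph
  open WeightedGraph weighted public
  open Paths weighted public
  field
    nonEmpty  : NonZero order
    adj?      : ∀ u v → Dec (Adj u v)
    connected : ∀ u v → Path u v
    -- The graph is simple, so a path is determined by its sequence of nodes.
    unique    : ∀ {u v} (π σ : Path u v) → IsShortest π → IsShortest σ → nodes π ≡ nodes σ

-- The geometric realization.  A point is a node or an interior point of an
-- edge; inner {u} {v} _ α is at distance α from u on the edge {u,v}.  Offsets
-- are rational.

module Realization (H : WeightedGraph) where
  open WeightedGraph H
  open Paths H

  data Point : Set where
    node  : V → Point
    inner : ∀ {u v} → Adj u v → (α : ℚ) → 0ℚ < α → α < ℓ u v → Point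

  -- Pos x u v α: x is an interior point of the edge {u,v}, at distance α from u.
  data Pos : Point → V → V → ℚ → Set where
    fwd : ∀ {u v} {e : Adj u v} {α p q} → Pos (inner e α p q) u v α
    bwd : ∀ {u v} {e : Adj u v} {α p q} → Pos (inner e α p q) v u (ℓ u v - α)

  -- Equality of points: an interior point has a representation for each
  -- orientation of its edge.
  data _≈_ : Point → Point → Set where
    node≈  : ∀ {u} → node u ≈ node u
    inner≈ : ∀ {x y u v α} → Pos x u v α → Pos y u v α → x ≈ y

  -- Leg x u a: u is x itself or an endpoint of the edge containing x, and the
  -- straight piece between x and u has length a.
  data Leg : Point → V → ℚ → Set where
    node  : ∀ {u} → Leg (node u) u 0ℚ
    inner : ∀ {x u v α} → Pos x u v α → Leg x u α

  -- Route x y d: there is a curve of length d from x to y which either stays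
  -- inside one edge, or leaves x to a node, follows a path of H, and reaches
  -- y from a node.
  data Route : Point → Point → ℚ → Set where
    along : ∀ {x y u v α β} → Pos x u v α → Pos y u v β → Route x y ∣ α - β ∣
    via   : ∀ {x y u v a b} → Leg x u a → (π : Path u v) → Leg y v b →
            Route x y (a + ∥ π ∥ + b)

  -- dist(x,y) = d in the realization
  IsDist~ : Point → Point → ℚ → Set
  IsDist~ x y d = Route x y d × (∀ {d′} → Route x y d′ → d ≤ d′)

  -- P has exactly k points, counted up to ≈.
  HasSize : (Point → Set) → ℕ → Set
  HasSize P k = ∃[ xs ] List.length xs ≡ k × All P xs
                × AllPairs (λ x y → ¬ (x ≈ y)) xs
                × (∀ x → P x → Any (x ≈_) xs)

-- A parameter p as a functional relation: p G k means p(G) = k.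
Parameter : Set₁
Parameter = Graph → ℕ → Set

IsLeast : (ℕ → Set) → ℕ → Set
IsLeast P k = P k × (∀ m → P m → k ℕ.≤ m)

IsGreatest : (ℕ → Set) → ℕ → Set
IsGreatest P k = P k × (∀ m → P m → m ℕ.≤ k)

module _ (G : Graph) where
  open Graph G

  -- The shortest path tree of s: the union of all shortest paths from s.
  ShortestPathTree : V → WeightedGraph
  ShortestPathTree s = record
    { V       = V
    ; order   = order
    ; finite  = finite
    ; Adj     = λ u v → ∃[ t ] Σ[ π ∈ Path s t ] IsShortest π × (Step u v π ⊎ Step v u π)
    ; irrefl  = λ (_ , _ , _ , e) → irrefl (adj e)
    ; adj-sym = λ (t , π , sh , e) → t , π , sh , swap e
    ; ℓ       = ℓ
    ; ℓ-sym   = λ (_ , _ , _ , e) → ℓ-sym (adj e)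
    ; ℓ-pos   = λ (_ , _ , _ , e) → ℓ-pos (adj e)
    }
    where
    adj : ∀ {u v a b} {π : Path a b} → Step u v π ⊎ Step v u π → Adj u v
    adj (inj₁ p) = step⇒adj p
    adj (inj₂ p) = adj-sym (step⇒adj p)

  module Skeleton (s : V) where
    open Realization (ShortestPathTree s) public

    -- In the tree rooted at s, w is a descendant of x iff x lies on the
    -- geodesic from s to w.
    Descendant : Point → Point → Set
    Descendant x w = ∃[ a ] ∃[ b ] IsDist~ (node s) x a × IsDist~ x w b
                                   × IsDist~ (node s) w (a + b)

    InSkeleton : Point → Set
    InSkeleton x = ∃[ w ] Descendant x w
                   × ∃[ a ] ∃[ b ] IsDist~ (node s) x a × IsDist~ x w b × ½ * a ≤ b

    InCut : ℚ → Point → Set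
    InCut r x = InSkeleton x × IsDist~ (node s) x r

  CutSize : ℕ → Set
  CutSize k = Σ[ s ∈ V ] ∃[ r ] 0ℚ ≤ r × Skeleton.HasSize s (Skeleton.InCut s r) k

  -- Hitting sets are lists of nodes: a set has at most k elements iff it is
  -- enumerated by a list of length at most k.  Since all weights are rational,
  -- all values at which the conditions on r change are rational, so that
  -- rational radii give the same parameters as real ones (also for Cut).

  Hits : ∀ {u v} → List V → Path u v → Set
  Hits S π = ∃[ x ] x ∈ S × x ∈ nodes π

  HD₁ : ℕ → Set
  HD₁ k = ∀ r → 0ℚ < r → ∀ u →
    Σ[ S ∈ List V ] All (InBall (+ 4 / 1 * r) u) S × List.length S ℕ.≤ k ×
      (∀ {a b} (π : Path a b) → IsShortest π → r < ∥ π ∥ →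
       All (InBall (+ 4 / 1 * r) u) (nodes π) → Hits S π)

  HD₂ : ℕ → Set
  HD₂ k = ∀ r → 0ℚ < r → ∀ u →
    Σ[ S ∈ List V ] List.length S ℕ.≤ k ×
      (∀ {a b} (π : Path a b) → IsShortest π → r < ∥ π ∥ → ∥ π ∥ ≤ + 2 / 1 * r →
       Any (InBall (+ 2 / 1 * r) u) (nodes π) → Hits S π)

hd₁ hd₂ κ : Parameter
hd₁ G = IsLeast (HD₁ G)
hd₂ G = IsLeast (HD₂ G)
κ   G = IsGreatest (CutSize G)

-- p(G) ≤ f(q(G)) for all G
BoundedBy : Parameter → Parameter → (ℕ → ℕ) → Set₁
BoundedBy p q f = ∀ G {a b} → p G a → q G b → a ℕ.≤ f b

Incomparable : Parameter → Parameter → Set₁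
Incomparable p q = ¬ ∃ (BoundedBy p q) × ¬ ∃ (BoundedBy q p)

{-# OPTIONS --safe #-}
module Submission where

-- In a star with n unit edges the centre hits every shortest path of positive
-- length, so hd₁ and hd₂ are at most 1, whereas the skeleton of the centre
-- contains the midpoint of every edge, so κ ≥ n.
--
-- For the converse take a spine of 2n nodes with a short tooth at each of them,
-- and join the tips of the teeth at distance n along the spine by rungs.  A rung
-- is the shortest path between its ends, but it is so little shorter than the
-- detour along the spine that no other shortest path uses it.  Hence a shortest
-- path tree contains at most the rung of its root, all other teeth are too short
-- for the skeleton, and κ ≤ 4.  The n rungs are pairwise disjoint shortest paths
-- of equal length in a ball of comparable radius, so hd₁ and hd₂ are at least n.

open import Defs
open import Data.Empty using (⊥; ⊥-elim)
open import Data.Fin.Base as Fin using (Fin; zero; suc; toℕ)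
import Data.Fin.Properties as Fin
open import Data.Integer.Base as ℤ using (+_)
import Data.Integer.Properties as ℤ
open import Data.List.Base as List using (List; []; _∷_)
open import Data.List.Membership.Propositional using (_∈_)
open import Data.List.Membership.Propositional.Properties using (∈-filter⁺; ∈-map⁺; ∈-allFin; ∈-lookup)
open import Data.List.Properties using (length-tabulate; length-filter)
open import Data.List.Relation.Unary.All as All using (All; []; _∷_)
import Data.List.Relation.Unary.All.Properties as All
open import Data.List.Relation.Unary.AllPairs using (AllPairs; []; _∷_)
import Data.List.Relation.Unary.AllPairs.Properties as AllPairs
open import Data.List.Relation.Unary.Any as Any using (Any; here; there)
import Data.List.Relation.Unary.Any.Properties as Any
open import Data.Nat.Base as ℕ using (ℕ; zero; suc; NonZero)
open import Data.Nat.Induction using (<-rec)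
import Data.Nat.Properties as ℕ
import Data.Nat.Tactic.RingSolver as ℕ-Solver
open import Data.Product.Base using (_×_; _,_; ∃; ∃-syntax; Σ-syntax; proj₁; proj₂)
open import Data.Rational.Base as ℚ using (ℚ; 0ℚ; ½)
open import Data.Rational.Literals using (fromℤ)
import Data.Rational.Properties as ℚ
import Data.Rational.Unnormalised.Base as ℚᵘ
import Data.Rational.Unnormalised.Properties as ℚᵘ
open import Data.Sum.Base using (_⊎_; inj₁; inj₂; [_,_]′)
open import Data.Unit.Base using (⊤; tt)
open import Function.Base using (_∘_; id)
open import Function.Bundles using (_↔_; Inverse)
open import Function.Construct.Identity using (↔-id)
open import Function.Construct.Symmetry using (↔-sym)
open import Relation.Binary.Construct.Closure.ReflexiveTransitive using (Star; ε; _◅_; _◅◅_)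
open import Relation.Binary.Definitions using (tri<; tri≈; tri>)
open import Relation.Binary.PropositionalEquality
open import Relation.Nullary using (¬_; Dec; yes; no; contradiction)
open import Relation.Nullary.Decidable using (dec⇒maybe; toWitness)
open import Tactic.RingSolver using (solve-∀)
open import Tactic.RingSolver.Core.AlmostCommutativeRing using (AlmostCommutativeRing; fromCommutativeRing)

-- Natural numbers as rational weights, and linear inequalities over the rationals.

opaque
  -- Both graphs have integer weights, so distances can be computed in `ℕ` and embedded by `ι`.
  -- Opacity stops the type checker from unfolding rational arithmetic; only the laws of this block
  -- are visible.
  ι : ℕ → ℚ
  ι n = fromℤ (+ n)

  ι-+ : ∀ m n → ι (m ℕ.+ n) ≡ ι m ℚ.+ ι n
  ι-+ m n = ℚ.toℚᵘ-injective (ℚᵘ.≃-trans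
    (ℚᵘ.*≡* (cong (ℤ._* (+ 1)) (sym (cong₂ ℤ._+_ (ℤ.*-identityʳ (+ m)) (ℤ.*-identityʳ (+ n))))))
    (ℚᵘ.≃-sym (ℚ.toℚᵘ-homo-+ (ι m) (ι n))))

  ι-mono-≤ : ∀ {m n} → m ℕ.≤ n → ι m ℚ.≤ ι n
  ι-mono-≤ p = ℚ.*≤* (ℤ.*-monoʳ-≤-nonNeg (+ 1) (ℤ.+≤+ p))

  ι-mono-< : ∀ {m n} → m ℕ.< n → ι m ℚ.< ι n
  ι-mono-< p = ℚ.*<* (ℤ.*-monoʳ-<-pos (+ 1) (ℤ.+<+ p))

  ι-cancel-< : ∀ {m n} → ι m ℚ.< ι n → m ℕ.< n
  ι-cancel-< {m} {n} p = ℕ.≰⇒> λ n≤m → ℚ.<-irrefl refl (ℚ.<-≤-trans p (ι-mono-≤ n≤m))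

  ι-injective : ∀ {m n} → ι m ≡ ι n → m ≡ n
  ι-injective = ℤ.+-injective ∘ cong ℚ.numerator

  ι-0 : ι 0 ≡ 0ℚ
  ι-0 = refl

  ι-nonNeg : ∀ n → 0ℚ ℚ.≤ ι n
  ι-nonNeg n = subst (ℚ._≤ ι n) ι-0 (ι-mono-≤ ℕ.z≤n)

  ι-numeral : ∀ n → ι n ≡ + n ℚ./ 1
  ι-numeral n = sym (ℚ.↥p/↧p≡p (ι n))

ℚ-ring : AlmostCommutativeRing _ _
ℚ-ring = fromCommutativeRing ℚ.+-*-commutativeRing (λ x → dec⇒maybe (0ℚ ℚ.≟ x))

module _ where
  open import Data.Rational.Base using (_+_; _≤_; _<_)

  -- The scheme for linear inequalities: the hypotheses are added up to one `p ≤ q`, and the rest is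
  -- an identity for the ring solver.
  ≤-by : ∀ {p q a b} → p ≤ q → b + p ≡ a + q → a ≤ b
  ≤-by {p} {q} {a} {b} p≤q eq = ℚ.≮⇒≥ λ b<a → ℚ.<-irrefl eq (ℚ.+-mono-<-≤ b<a p≤q)

  <-by : ∀ {p q a b} → p < q → b + p ≡ a + q → a < b
  <-by {p} {q} {a} {b} p<q eq = ℚ.≰⇒> λ b≤a → ℚ.<-irrefl eq (ℚ.+-mono-≤-< b≤a p<q)

module _ where
  open import Data.Rational.Base using (_+_; _≤_)

  chain-≤ : ∀ t w u l p → t ≤ w + p → w ≤ u + l → t ≤ u + (l + p)
  chain-≤ t w u l p h k = ≤-by (ℚ.+-mono-≤ h k) (eq t w u l p)
    where
    eq : ∀ t w u l p → (u + (l + p)) + (t + w) ≡ t + ((w + p) + (u + l))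
    eq = solve-∀ ℚ-ring

-- Graphs with a certified distance function.

-- The conditions on single edges from d-self on force d to be the distance
-- function and shortest paths to be unique.
record CertifiedGraph : Set₁ where
  field
    V        : Set
    order    : ℕ
    finite   : V ↔ Fin order
    nonEmpty : NonZero order
    Adj      : V → V → Set
    irrefl   : ∀ {u} → ¬ Adj u u
    adj-sym  : ∀ {u v} → Adj u v → Adj v u
    adj?     : ∀ u v → Dec (Adj u v)
    len      : V → V → ℕ
    len-sym  : ∀ {u v} → Adj u v → len u v ≡ len v u
    len-pos  : ∀ {u v} → Adj u v → 0 ℕ.< len u v
    d        : V → V → ℕ
    d-self   : ∀ s → d s s ≡ 0
    d-sym    : ∀ u v → d u v ≡ d v u
    d-lip    : ∀ s {u v} → Adj u v → d s v ℕ.≤ d s u ℕ.+ len u v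

  -- The edges on which `d-lip` is an equality: the edges of the shortest path tree of `s`, directed
  -- away from `s`.
  Child : V → V → V → Set
  Child s u v = Adj u v × d s v ≡ d s u ℕ.+ len u v

  field
    parent        : ∀ s v → s ≡ v ⊎ ∃ λ u → Child s u v
    parent-unique : ∀ s {u u′ v} → Child s u v → Child s u′ v → u ≡ u′

  child-< : ∀ {s u v} → Child s u v → d s u ℕ.< d s v
  child-< {s} {u} (e , eq) = subst (d s u ℕ.<_) (sym eq) (ℕ.m<m+n (d s u) (len-pos e))

  ¬child-root : ∀ {s u} → ¬ Child s u s
  ¬child-root {s} {u} c = ℕ.n≮0 (subst (d s u ℕ.<_) (d-self s) (child-< c))

  weighted : WeightedGraph
  weighted = record
    { V = V ; order = order ; finite = finite ; Adj = Adj ; irrefl = irrefl ; adj-sym = adj-sym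
    ; ℓ = λ u v → ι (len u v) ; ℓ-sym = cong ι ∘ len-sym
    ; ℓ-pos = λ {u} {v} e → subst (ℚ._< ι (len u v)) ι-0 (ι-mono-< (len-pos e)) }

module Certified (C : CertifiedGraph) where
  open CertifiedGraph C
  open WeightedGraph weighted using (ℓ; ℓ-sym; ℓ-pos)
  open Paths weighted
  open import Data.Rational.Base using (_+_; _*_; _≤_; _<_)

  D : V → V → ℚ
  D s v = ι (d s v)

  D-self : ∀ s → D s s ≡ 0ℚ
  D-self s = trans (cong ι (d-self s)) ι-0

  D-lip : ∀ s {u v} → Adj u v → D s v ≤ D s u + ℓ u v
  D-lip s {u} {v} e = subst (D s v ≤_) (ι-+ (d s u) (len u v)) (ι-mono-≤ (d-lip s e))

  D-child : ∀ {s u v} → Child s u v → D s v ≡ D s u + ℓ u v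
  D-child {s} {u} {v} (_ , eq) = trans (cong ι eq) (ι-+ (d s u) (len u v))

  path-lip : ∀ s {u v} (π : Path u v) → D s v ≤ D s u + ∥ π ∥
  path-lip s {u} []      = ℚ.≤-reflexive (sym (ℚ.+-identityʳ (D s u)))
  path-lip s {u} {t} (_∷_ {v = v} e π) = chain-≤ (D s t) (D s v) (D s u) (ℓ u v) ∥ π ∥ (path-lip s π) (D-lip s e)

  D≤path : ∀ {s v} (π : Path s v) → D s v ≤ ∥ π ∥
  D≤path {s} {v} π = subst (D s v ≤_) (trans (cong (_+ ∥ π ∥) (D-self s)) (ℚ.+-identityˡ ∥ π ∥)) (path-lip s π)

  D≤path′ : ∀ {s v} (π : Path v s) → D s v ≤ ∥ π ∥
  D≤path′ {s} {v} π = subst (_≤ ∥ π ∥) (cong ι (d-sym v s)) (D≤path π)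

  -- Parents are followed from `v`; `d s` drops strictly at each step because weights are positive,
  -- so the walk ends at `s`. With `path-lip` this makes `D` the distance.
  toRoot : ∀ s v → Σ[ π ∈ Path v s ] ∥ π ∥ ≡ D s v
  toRoot s v = <-rec (λ n → ∀ v → d s v ≡ n → Σ[ π ∈ Path v s ] ∥ π ∥ ≡ D s v) step (d s v) v refl
    where
    step : ∀ n → (∀ {m} → m ℕ.< n → ∀ v → d s v ≡ m → Σ[ π ∈ Path v s ] ∥ π ∥ ≡ D s v) →
           ∀ v → d s v ≡ n → Σ[ π ∈ Path v s ] ∥ π ∥ ≡ D s v
    step n rec v refl with parent s v
    ... | inj₁ refl = [] , sym (D-self s)
    ... | inj₂ (u , c) with rec (child-< c) u refl
    ...   | π , eq = adj-sym (proj₁ c) ∷ π ,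
                     trans (cong₂ _+_ (ℓ-sym (adj-sym (proj₁ c))) eq)
                         (trans (ℚ.+-comm (ℓ u v) (D s u)) (sym (D-child c)))

  fromRoot : ∀ s v → Σ[ π ∈ Path s v ] ∥ π ∥ ≡ D s v
  fromRoot s v with toRoot v s
  ... | π , eq = π , trans eq (cong ι (d-sym v s))

  tight⇒shortest : ∀ {s v} (π : Path s v) → ∥ π ∥ ≡ D s v → IsShortest π
  tight⇒shortest π eq σ = subst (_≤ ∥ σ ∥) (sym eq) (D≤path σ)

  shortest⇒tight : ∀ {s v} (π : Path s v) → IsShortest π → ∥ π ∥ ≡ D s v
  shortest⇒tight {s} {v} π sh with fromRoot s v
  ... | σ , eq = ℚ.≤-antisym (subst (∥ π ∥ ≤_) eq (sh σ)) (D≤path π)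

  -- Both `D s u ≤ D s v + ℓ u v` and `D s v ≤ ∥ π ∥` hold in any case; a path attaining `D s u`
  -- forces equality in each.
  uncons-tight : ∀ {s u v} (e : Adj u v) (π : Path v s) → ∥ e ∷ π ∥ ≡ D s u → Child s v u × ∥ π ∥ ≡ D s v
  uncons-tight {s} {u} {v} e π eq = (adj-sym e , ι-injective (trans Du≡ (sym (ι-+ (d s v) (len v u))))) , π≡
    where
    upper : D s u ≤ D s v + ℓ u v
    upper = subst (λ l → D s u ≤ D s v + l) (ℓ-sym (adj-sym e)) (D-lip s (adj-sym e))

    solve-eq : ∀ a l p → a + (l + p) ≡ p + (a + l)
    solve-eq = solve-∀ ℚ-ring

    π≡ : ∥ π ∥ ≡ D s v
    π≡ = ℚ.≤-antisym (≤-by upper (trans (cong (λ x → D s v + x) (sym eq)) (solve-eq (D s v) (ℓ u v) ∥ π ∥)))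
        (D≤path′ π)

    Du≡ : D s u ≡ D s v + ℓ v u
    Du≡ = trans (sym eq) (trans (cong₂ _+_ (ℓ-sym e) π≡) (ℚ.+-comm (ℓ v u) (D s v)))

  -- Read towards the root, a shortest path can only move to the unique parent of its current node.
  tight-nodes : ∀ {s u} (π σ : Path u s) → ∥ π ∥ ≡ D s u → ∥ σ ∥ ≡ D s u → nodes π ≡ nodes σ
  tight-nodes []      []      p q = refl
  tight-nodes []      (e ∷ σ) p q = ⊥-elim (¬child-root (proj₁ (uncons-tight e σ q)))
  tight-nodes (e ∷ σ) []      q p = ⊥-elim (¬child-root (proj₁ (uncons-tight e σ q)))
  tight-nodes {s} {u} (e ∷ π) (f ∷ σ) p q = cong (u ∷_) (tails π σ (uncons-tight e π p) (uncons-tight f σ q))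
    where
    tails : ∀ {v w} (π : Path v s) (σ : Path w s) → Child s v u × ∥ π ∥ ≡ D s v → Child s w u × ∥ σ ∥ ≡ D s w →
        nodes π ≡ nodes σ
    tails π σ (c , p) (c′ , q) with refl ← parent-unique s c c′ = tight-nodes π σ p q

  graph : Graph
  graph = record
    { weighted = weighted ; nonEmpty = nonEmpty ; adj? = adj? ; connected = λ u v → proj₁ (fromRoot u v)
    ; unique = λ {u} {v} π σ p q → tight-nodes π σ (tight u v π p) (tight u v σ q) }
    where
    -- `tight-nodes` has its root at the end of the path, so the symmetry of `d` is used to measure
    -- from `v`.
    tight : ∀ u v (π : Path u v) → IsShortest π → ∥ π ∥ ≡ D v u
    tight u v π p = trans (shortest⇒tight π p) (cong ι (d-sym u v))

  inBall : ∀ {r u v} → D u v ≤ r → InBall r u v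
  inBall {r} {u} {v} p with fromRoot u v
  ... | π , eq = D u v , (π , tight⇒shortest π eq , eq) , p

  inBall⁻¹ : ∀ {r u v} → InBall r u v → D u v ≤ r
  inBall⁻¹ {r} (_ , (π , sh , eq) , p) = subst (_≤ r) (trans (sym eq) (shortest⇒tight π sh)) p

  vertices : List V
  vertices = List.map (Inverse.from finite) (List.allFin order)

  ∈-vertices : ∀ v → v ∈ vertices
  ∈-vertices v = subst (_∈ vertices) (Inverse.strictlyInverseʳ finite v)
      (∈-map⁺ (Inverse.from finite) (∈-allFin (Inverse.to finite v)))

  head∈nodes : ∀ {u v} (π : Path u v) → u ∈ nodes π
  head∈nodes []      = here refl
  head∈nodes (_ ∷ _) = here refl

  HD₂-exists : HD₂ graph (List.length vertices)
  HD₂-exists r 0<r u = vertices , ℕ.≤-refl , λ {a} π _ _ _ _ → a , ∈-vertices a , head∈nodes π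

  -- The hitting set must lie in the ball, so all nodes are filtered by membership in it; the first
  -- node of a path inside the ball survives.
  HD₁-exists : HD₁ graph (List.length vertices)
  HD₁-exists r 0<r u =
      List.filter near vertices , All.map inBall (All.all-filter near vertices) , length-filter near vertices ,
    λ {a} π _ _ inside → a , ∈-filter⁺ near (∈-vertices a) (inBall⁻¹ (All.lookup inside (head∈nodes π))) ,
        head∈nodes π
    where
    near : ∀ v → Dec (D u v ≤ + 4 ℚ./ 1 * r)
    near v = D u v ℚ.≤? + 4 ℚ./ 1 * r

-- The shortest path tree of a node.

module RootedTree (C : CertifiedGraph) (s : CertifiedGraph.V C) where
  open CertifiedGraph C
  open WeightedGraph weighted using (ℓ; ℓ-sym; ℓ-pos)
  open Certified C
  open Paths weighted using (Path; []; _∷_; ∥_∥; IsShortest; Step; here; there)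
  open import Data.Rational.Base using (_+_; _-_; _*_; -_; _≤_; _<_; ∣_∣)

  T : WeightedGraph
  T = ShortestPathTree graph s

  open Skeleton graph s
  module T = Paths T

  -- Equality in the sum of the Lipschitz bounds along a path forces equality on each edge. The
  -- start `a` is arbitrary so that the induction can pass to a suffix.
  tight-step : ∀ {u v a t} (π : Path a t) → D s a + ∥ π ∥ ≤ D s t → Step u v π → Child s u v
  tight-step {a = a} {t} (_∷_ {v = w} e π) p st = go st
    where
    tight : D s w ≡ D s a + ℓ a w
    tight = ℚ.≤-antisym (D-lip s e) (≤-by (ℚ.+-mono-≤ (path-lip s π) p) (eq (D s a) (D s w) (ℓ a w) ∥ π ∥ (D s t)))
      where
      eq : ∀ a w l p t → w + (t + (a + (l + p))) ≡ (a + l) + ((w + p) + t)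
      eq = solve-∀ ℚ-ring

    rest : D s w + ∥ π ∥ ≤ D s t
    rest = subst (_≤ D s t) (trans (sym (ℚ.+-assoc (D s a) (ℓ a w) ∥ π ∥)) (cong (_+ ∥ π ∥) (sym tight))) p

    go : ∀ {u v} → Step u v (e ∷ π) → Child s u v
    go here       = e , ι-injective (trans tight (sym (ι-+ (d s a) (len a w))))
    go (there st) = tight-step π rest st

  tree-edge : ∀ {u v} → WeightedGraph.Adj T u v → Child s u v ⊎ Child s v u
  tree-edge (t , π , sh , e) = [ inj₁ ∘ tight-step π tight , inj₂ ∘ tight-step π tight ]′ e
    where
    tight : D s s + ∥ π ∥ ≤ D s t
    tight = ℚ.≤-reflexive (trans (cong (_+ ∥ π ∥) (D-self s)) (trans (ℚ.+-identityˡ ∥ π ∥) (shortest⇒tight π sh)))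

  tree-lip : ∀ {u v} → WeightedGraph.Adj T u v → D s v ≤ D s u + ℓ u v
  tree-lip e = [ D-lip s ∘ proj₁ , D-lip s ∘ adj-sym ∘ proj₁ ]′ (tree-edge e)

  tree-path-lip : ∀ {u v} (π : T.Path u v) → D s v ≤ D s u + T.∥ π ∥
  tree-path-lip {u} T.[] = ℚ.≤-reflexive (sym (ℚ.+-identityʳ (D s u)))
  tree-path-lip {u} {t} (T._∷_ {v = v} e π) =
    chain-≤ (D s t) (D s v) (D s u) (ℓ u v) T.∥ π ∥ (tree-path-lip π) (tree-lip e)

  -- A shortest path from `s` in the graph is itself the witness that all its edges belong to the
  -- tree, so it lifts with its length.
  tree-path : ∀ v → Σ[ π ∈ T.Path s v ] T.∥ π ∥ ≡ D s v
  tree-path v with fromRoot s v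
  ... | π , eq with lift π (λ st → v , π , tight⇒shortest π eq , inj₁ st)
    where
    lift : ∀ {a b} (σ : Path a b) → (∀ {x y} → Step x y σ → WeightedGraph.Adj T x y) →
        Σ[ τ ∈ T.Path a b ] T.∥ τ ∥ ≡ ∥ σ ∥
    lift []      f = T.[] , refl
    lift (_∷_ {a} {w} e σ) f with lift σ (f ∘ there)
    ... | τ , eq = f here T.∷ τ , cong (λ x → ℓ a w + x) eq
  ...   | τ , eq′ = τ , trans eq′ eq

  Descends : V → V → Set
  Descends = Star (Child s)

  -- A path that gains as much distance from the root as its length cannot contain a step towards
  -- the root.
  ascent : ∀ {u v} (π : T.Path u v) → D s u + T.∥ π ∥ ≤ D s v → Descends u v
  ascent T.[] p = ε
  ascent {u} {t} (T._∷_ {v = v} e π) p with tree-edge e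
  ... | inj₁ c = c ◅ ascent π (subst (_≤ D s t) (trans (sym (ℚ.+-assoc (D s u) (ℓ u v) T.∥ π ∥))
      (cong (_+ T.∥ π ∥) (sym (D-child c)))) p)
  ... | inj₂ c = ⊥-elim (ℚ.<-irrefl refl (ℚ.<-≤-trans (ι-mono-< (child-< c))
      (≤-by (ℚ.+-mono-≤ (ℚ.+-mono-≤ p (tree-path-lip π)) (ℚ.<⇒≤ (ℓ-pos (adj-sym (proj₁ c)))))
      (eq (D s u) (D s v) (ℓ u v) T.∥ π ∥ (D s t)))))
    where
    eq : ∀ u v l p t → v + (((u + (l + p)) + t) + 0ℚ) ≡ u + ((t + (v + p)) + l)
    eq = solve-∀ ℚ-ring

  -- Distances from the root in the realization of the tree, and the skeleton.

  -- Height x v t: the edge containing x ends, away from the root, in v (v = x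
  -- for a node x), and x is at distance t from the root.
  data Height : Point → V → ℚ → Set where
    node  : ∀ {v} → Height (node v) v (D s v)
    inner : ∀ {x u v α} → Pos x u v α → Child s u v → Height x v (D s u + α)

  height : ∀ x → ∃[ v ] ∃[ t ] Height x v t
  height (node v) = v , D s v , node
  height (inner {u} {v} e α p q) with tree-edge e
  ... | inj₁ c = v , D s u + α , inner fwd c
  ... | inj₂ c = u , D s v + (ℓ u v - α) , inner bwd c

  pos-pos : ∀ {x u v α} → Pos x u v α → 0ℚ < α
  pos-pos (fwd {p = p}) = p
  pos-pos (bwd {u} {v} {α = α} {q = q}) = <-by q (eq (ℓ u v) α)
    where
    eq : ∀ l a → (l - a) + a ≡ 0ℚ + l
    eq = solve-∀ ℚ-ring

  pos-< : ∀ {x u v α} → Pos x u v α → α < ℓ u v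
  pos-< (fwd {q = q}) = q
  pos-< (bwd {u} {v} {e} {α} {p = p}) = subst (ℓ u v - α <_) (WeightedGraph.ℓ-sym T e) (<-by p (eq (ℓ u v) α))
    where
    eq : ∀ l a → l + 0ℚ ≡ (l - a) + a
    eq = solve-∀ ℚ-ring

  pos-unique : ∀ {x u v u′ v′ α β} → Pos x u v α → Pos x u′ v′ β →
               (u′ ≡ u × v′ ≡ v × β ≡ α) ⊎ (u′ ≡ v × v′ ≡ u × β + α ≡ ℓ u v)
  pos-unique fwd fwd = inj₁ (refl , refl , refl)
  pos-unique bwd bwd = inj₁ (refl , refl , refl)
  pos-unique (fwd {u} {v} {α = α}) bwd = inj₂ (refl , refl , eq (ℓ u v) α)
    where
    eq : ∀ l a → (l - a) + a ≡ l
    eq = solve-∀ ℚ-ring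
  pos-unique (bwd {u} {v} {e} {α = α}) fwd = inj₂ (refl , refl , trans (eq (ℓ u v) α) (WeightedGraph.ℓ-sym T e))
    where
    eq : ∀ l a → a + (l - a) ≡ l
    eq = solve-∀ ℚ-ring

  pos-height : ∀ {x u v α w t} → Pos x u v α → Height x w t →
               (w ≡ v × Child s u v × t ≡ D s u + α) ⊎ (w ≡ u × Child s v u × t + α ≡ D s u)
  pos-height {α = α} p (inner q c) with pos-unique p q
  ... | inj₁ (refl , refl , refl) = inj₁ (refl , c , refl)
  pos-height {u = u} {v} {α} p (inner {α = β} q c) | inj₂ (refl , refl , eq) =
    inj₂ (refl , c , trans (ℚ.+-assoc (D s v) β α) (trans
        (cong (λ x → D s v + x) (trans eq (ℓ-sym (adj-sym (proj₁ c))))) (sym (D-child c))))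

  -- The node reached by a leg is either the far end of the edge of `x` (or `x` itself), or the end
  -- nearer to the root.
  leg-height : ∀ {x u a w t} → Leg x u a → Height x w t →
               (w ≡ u × t + a ≡ D s u) ⊎ (Child s u w × t ≡ D s u + a × 0ℚ < a)
  leg-height {u = u} node node = inj₁ (refl , ℚ.+-identityʳ (D s u))
  leg-height (inner p) h with pos-height p h
  ... | inj₁ (refl , c , eq) = inj₂ (c , eq , pos-pos p)
  ... | inj₂ (refl , c , eq) = inj₁ (refl , eq)

  leg-up : ∀ {x u a w t} → Leg x u a → Height x w t → D s u ≤ t + a
  leg-up {u = u} {a} {t = t} l h with leg-height l h
  ... | inj₁ (_ , eq) = ℚ.≤-reflexive (sym eq)
  ... | inj₂ (_ , eq , 0<a) =
      ≤-by (ℚ.+-mono-≤ (ℚ.<⇒≤ 0<a) (ℚ.<⇒≤ 0<a)) (trans (cong (λ x → (x + a) + (0ℚ + 0ℚ)) eq) (ring (D s u) a))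
    where
    ring : ∀ u a → ((u + a) + a) + (0ℚ + 0ℚ) ≡ u + (a + a)
    ring = solve-∀ ℚ-ring

  leg-nonNeg : ∀ {x u a} → Leg x u a → 0ℚ ≤ a
  leg-nonNeg node      = ℚ.≤-refl
  leg-nonNeg (inner p) = ℚ.<⇒≤ (pos-pos p)

  leg-down : ∀ {x u a w t} → Leg x u a → Height x w t → t ≤ D s u + a
  leg-down {u = u} {a} {t = t} l h with leg-height l h
  ... | inj₂ (_ , eq , _) = ℚ.≤-reflexive eq
  ... | inj₁ (_ , eq) =
      ≤-by (ℚ.+-mono-≤ (leg-nonNeg l) (leg-nonNeg l)) (trans (cong (λ x → (x + a) + (0ℚ + 0ℚ)) (sym eq)) (ring t a))
    where
    ring : ∀ u a → ((u + a) + a) + (0ℚ + 0ℚ) ≡ u + (a + a)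
    ring = solve-∀ ℚ-ring

  x≤∣x∣ : ∀ x → x ≤ ∣ x ∣
  x≤∣x∣ x with ℚ.∣p∣≡p∨∣p∣≡-p x
  ... | inj₁ eq = ℚ.≤-reflexive (sym eq)
  ... | inj₂ eq = ℚ.≮⇒≥ λ lt → ℚ.<-irrefl refl (ℚ.<-≤-trans lt
      (≤-by (ℚ.+-mono-≤ (ℚ.0≤∣p∣ x) (ℚ.0≤∣p∣ x)) (trans (cong (λ y → y + (0ℚ + 0ℚ)) eq)
      (trans (ring x) (cong (λ y → x + (y + y)) (sym eq))))))
    where
    ring : ∀ x → - x + (0ℚ + 0ℚ) ≡ x + (- x + - x)
    ring = solve-∀ ℚ-ring

  -- Height is 1-Lipschitz along every curve, so together with `height-route` it is the distance
  -- from the root.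
  route-lip : ∀ {x y c v w t t′} → Route x y c → Height x v t → Height y w t′ → t′ ≤ t + c
  route-lip {t = t} {t′} (along {u = u} {v} {α} {β} p q) h k with pos-height p h | pos-height q k
  ... | inj₁ (_ , _ , eq) | inj₁ (_ , _ , eq′) =
    ≤-by (x≤∣x∣ (β - α)) (trans (cong₂ (λ a b → (a + b) + (β - α)) eq ∣-∣-sym)
        (trans (ring (D s u) α β ∣ β - α ∣) (cong (_+ ∣ β - α ∣) (sym eq′))))
    where
    ∣-∣-sym : ∣ α - β ∣ ≡ ∣ β - α ∣
    ∣-∣-sym = trans (sym (ℚ.∣-p∣≡∣p∣ (α - β))) (cong ∣_∣ (neg α β))
      where
      neg : ∀ a b → - (a - b) ≡ b - a
      neg = solve-∀ ℚ-ring

    ring : ∀ u a b c → ((u + a) + c) + (b - a) ≡ (u + b) + c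
    ring = solve-∀ ℚ-ring
  ... | inj₁ (_ , c , _) | inj₂ (_ , c′ , _) = ⊥-elim (ℕ.<-asym (child-< c) (child-< c′))
  ... | inj₂ (_ , c , _) | inj₁ (_ , c′ , _) = ⊥-elim (ℕ.<-asym (child-< c) (child-< c′))
  ... | inj₂ (_ , _ , eq) | inj₂ (_ , _ , eq′) =
    ≤-by (x≤∣x∣ (α - β)) (ring t t′ α β ∣ α - β ∣ (trans eq (sym eq′)))
    where
    ring : ∀ t t′ a b c → t + a ≡ t′ + b → (t + c) + (a - b) ≡ t′ + c
    ring t t′ a b c eq = trans (lhs t a b c) (trans (cong (λ x → (x - b) + c) eq) (rhs t′ b c))
      where
      lhs : ∀ t a b c → (t + c) + (a - b) ≡ ((t + a) - b) + c
      lhs = solve-∀ ℚ-ring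
      rhs : ∀ t b c → ((t + b) - b) + c ≡ t + c
      rhs = solve-∀ ℚ-ring
  route-lip {t = t} {t′} (via {u = u} {v} {a} {b} l π l′) h k =
    ≤-by (ℚ.+-mono-≤ (ℚ.+-mono-≤ (leg-up l h) (tree-path-lip π)) (leg-down l′ k))
        (ring (D s u) (D s v) a b T.∥ π ∥ t t′)
    where
    ring : ∀ u v a b p t t′ → (t + (a + p + b)) + ((u + v) + t′) ≡ t′ + (((t + a) + (u + p)) + (v + b))
    ring = solve-∀ ℚ-ring

  -- The equality case of `route-lip`: leaving `x` towards the root would waste twice the first leg,
  -- so the route passes the far end of the edge of `x`, and `ascent` applies to its middle part.
  route-descends : ∀ {x y c v w t t′} → Route x y c → Height x v t → Height y w t′ → t + c ≤ t′ → Descends v w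
  route-descends (along p q) h k _ with pos-height p h | pos-height q k
  ... | inj₁ (refl , _) | inj₁ (refl , _) = ε
  ... | inj₂ (refl , _) | inj₂ (refl , _) = ε
  ... | inj₁ (_ , c , _) | inj₂ (_ , c′ , _) = ⊥-elim (ℕ.<-asym (child-< c) (child-< c′))
  ... | inj₂ (_ , c , _) | inj₁ (_ , c′ , _) = ⊥-elim (ℕ.<-asym (child-< c) (child-< c′))
  route-descends {v = v₀} {w₀} {t = t} {t′} (via {u = u} {v} {a} {b} l π l′) h k p = down (leg-height l h)
    where
    down : (v₀ ≡ u × t + a ≡ D s u) ⊎ (Child s u v₀ × t ≡ D s u + a × 0ℚ < a) → Descends v₀ w₀
    down (inj₂ (_ , eq , 0<a)) = ⊥-elim (ℚ.<-irrefl refl (ℚ.<-≤-trans lt p))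
      where
      ring : ∀ t u v a b p t′ → (t + (a + p + b)) + ((0ℚ + 0ℚ) + ((t′ + v) + (u + a))) ≡
           t′ + ((a + a) + (((v + b) + (u + p)) + t))
      ring = solve-∀ ℚ-ring

      lt : t′ < t + (a + T.∥ π ∥ + b)
      lt = <-by (ℚ.+-mono-<-≤ (ℚ.+-mono-< 0<a 0<a) (ℚ.+-mono-≤ (ℚ.+-mono-≤ (leg-down l′ k) (tree-path-lip π))
          (ℚ.≤-reflexive (sym eq))))
                (ring t (D s u) (D s v) a b T.∥ π ∥ t′)
    down (inj₁ (refl , eq)) = ascent π tight ◅◅ last (leg-height l′ k)
      where
      ring : ∀ t u v a b p t′ → v + (((t + (a + p + b)) + t′) + u) ≡ (u + p) + ((t′ + (v + b)) + (t + a))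
      ring = solve-∀ ℚ-ring

      tight : D s u + T.∥ π ∥ ≤ D s v
      tight = ≤-by (ℚ.+-mono-≤ (ℚ.+-mono-≤ p (leg-down l′ k)) (ℚ.≤-reflexive (sym eq)))
          (ring t (D s u) (D s v) a b T.∥ π ∥ t′)

      last : (w₀ ≡ v × t′ + b ≡ D s v) ⊎ (Child s v w₀ × t′ ≡ D s v + b × 0ℚ < b) → Descends v w₀
      last (inj₁ (refl , _)) = ε
      last (inj₂ (c , _))    = c ◅ ε

  height-≤ : ∀ {x v t} → Height x v t → t ≤ D s v
  height-≤ node = ℚ.≤-refl
  height-≤ (inner {u = u} p c) = subst (_ ≤_) (sym (D-child c)) (ℚ.+-monoʳ-≤ (D s u) (ℚ.<⇒≤ (pos-< p)))

  height-parent : ∀ {x v t} → Height x v t → (v ≡ s × t ≡ 0ℚ) ⊎ ∃ λ u → Child s u v × D s u < t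
  height-parent (node {v}) with parent s v
  ... | inj₁ refl = inj₁ (refl , D-self s)
  ... | inj₂ (u , c) = inj₂ (u , c , ι-mono-< (child-< c))
  height-parent (inner {u = u} {α = α} p c) =
    inj₂ (u , c , subst (_< D s u + α) (ℚ.+-identityʳ (D s u)) (ℚ.+-monoʳ-< (D s u) (pos-pos p)))

  -- The node `v` has one parent and so determines the edge; the height then fixes the position on
  -- it. Interior points stay strictly below the value `D s v` taken at the node.
  height-injective : ∀ {x y v t t′} → Height x v t → Height y v t′ → t ≡ t′ → x ≈ y
  height-injective node node _ = node≈
  height-injective node (inner {u = u} p c) eq =
    ⊥-elim (ℚ.<-irrefl (trans (sym eq) (D-child c)) (ℚ.+-monoʳ-< (D s u) (pos-< p)))
  height-injective (inner {u = u} p c) node eq =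
    ⊥-elim (ℚ.<-irrefl (trans eq (D-child c)) (ℚ.+-monoʳ-< (D s u) (pos-< p)))
  height-injective (inner {u = u} {α = α} p c) (inner {α = β} q c′) eq with refl ← parent-unique s c c′ =
      inner≈ p (subst (Pos _ _ _) (sym α≡β) q)
    where
    ring : ∀ u a → (u + a) - u ≡ a
    ring = solve-∀ ℚ-ring

    α≡β : α ≡ β
    α≡β = trans (sym (ring (D s u) α)) (trans (cong (_- D s u) eq) (ring (D s u) β))

  height-route : ∀ {x v t} → Height x v t → Route (node s) x t
  height-route (node {v}) with tree-path v
  ... | π , eq = subst (Route (node s) (node v)) (trans (ring T.∥ π ∥) eq) (via node π node)
    where
    ring : ∀ p → 0ℚ + p + 0ℚ ≡ p
    ring = solve-∀ ℚ-ring
  height-route {x} (inner {u = u} {α = α} p c) with tree-path u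
  ... | π , eq =
      subst (Route (node s) x) (trans (cong (_+ α) (ℚ.+-identityˡ T.∥ π ∥)) (cong (_+ α) eq)) (via node π (inner p))

  height-IsDist : ∀ {x v t} → Height x v t → IsDist~ (node s) x t
  height-IsDist {t = t} h = height-route h , λ {c} ρ → subst (t ≤_)
      (trans (cong (_+ c) (D-self s)) (ℚ.+-identityˡ c)) (route-lip ρ node h)

  IsDist-unique : ∀ {x y a b} → IsDist~ x y a → IsDist~ x y b → a ≡ b
  IsDist-unique (ρ , m) (σ , n) = ℚ.≤-antisym (m σ) (n ρ)

  -- The descendant that puts `x` into the skeleton is pushed on to the far end `y` of its edge,
  -- which turns the skeleton condition into one on nodes.
  skeleton-descends : ∀ {x v t} → InSkeleton x → Height x v t → ∃ λ y → Descends v y × ½ * t + t ≤ D s y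
  skeleton-descends {t = t} (w , (a , b , sx , xw , sw) , a′ , b′ , sx′ , xw′ , half) h with height w
  ... | y , t′ , k = y , route-descends (proj₁ xw) h k (ℚ.≤-reflexive (sym t′≡)) , ℚ.≤-trans bound (height-≤ k)
    where
    a≡t : a ≡ t
    a≡t = IsDist-unique sx (height-IsDist h)

    t′≡ : t′ ≡ t + b
    t′≡ = trans (IsDist-unique (height-IsDist k) sw) (cong (_+ b) a≡t)

    half′ : ½ * t ≤ b
    half′ = subst₂ (λ a b → ½ * a ≤ b) (trans (IsDist-unique sx′ sx) a≡t) (IsDist-unique xw′ xw) half

    bound : ½ * t + t ≤ t′
    bound = subst₂ _≤_ (ℚ.+-comm t (½ * t)) (sym t′≡) (ℚ.+-monoʳ-≤ t half′)

  -- The skeleton condition over `ℕ`: a point beyond `u` at height `t` needs a node `y` with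
  -- `3t/2 ≤ d s y`, whence `3 · d s u < 2 · d s y`. It is strict because the point lies strictly
  -- beyond `u`.
  Significant : V → V → Set
  Significant u v = ∃ λ y → Descends v y × d s u ℕ.+ d s u ℕ.+ d s u ℕ.< d s y ℕ.+ d s y

  significant : ∀ {x u v t} → InSkeleton x → Height x v t → D s u < t → Significant u v
  significant {u = u} {t = t} sk h lt with skeleton-descends sk h
  ... | y , v⊒y , p = y , v⊒y , ι-cancel-< (subst₂ _<_ (sym eqˡ) (sym (ι-+ (d s y) (d s y))) bound)
    where
    eqˡ : ι (d s u ℕ.+ d s u ℕ.+ d s u) ≡ D s u + D s u + D s u
    eqˡ = trans (ι-+ (d s u ℕ.+ d s u) (d s u)) (cong (_+ D s u) (ι-+ (d s u) (d s u)))

    ring : ∀ t y u → (y + y) + (((u + u) + u) + ((½ * t + t) + (½ * t + t))) ≡ (u + u + u) + (((t + t) + t) + (y + y))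
    ring = solve-∀ ℚ-ring

    bound : D s u + D s u + D s u < D s y + D s y
    bound = <-by (ℚ.+-mono-<-≤ (ℚ.+-mono-< (ℚ.+-mono-< lt lt) lt) (ℚ.+-mono-≤ p p)) (ring t (D s y) (D s u))

  cut-height : ∀ {x v r t} → InCut r x → Height x v t → t ≡ r
  cut-height (_ , δ) h = IsDist-unique (height-IsDist h) δ

  -- Exhibits one cut size, from which the search for the largest one can start.
  root-cut : HasSize (InCut 0ℚ) 1
  root-cut = node s ∷ [] , refl , (sk , dist₀) ∷ [] , [] ∷ [] , λ x c → here (at-root c (proj₂ (proj₂ (height x))))
    where
    dist₀ : IsDist~ (node s) (node s) 0ℚ
    dist₀ = subst (IsDist~ (node s) (node s)) (D-self s) (height-IsDist node)

    sk : InSkeleton (node s)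
    sk = node s , (0ℚ , 0ℚ , dist₀ , dist₀ , dist₀) , 0ℚ , 0ℚ , dist₀ , dist₀ , ℚ.≤-refl

    at-root : ∀ {x v t} → InCut 0ℚ x → Height x v t → x ≈ node s
    at-root c h with height-parent h
    ... | inj₁ (refl , eq) = height-injective h node (trans eq (sym (D-self s)))
    ... | inj₂ (u , _ , lt) =
        ⊥-elim (ℚ.<-irrefl refl (ℚ.<-≤-trans (subst (D s u <_) (cut-height c h) lt) (ι-nonNeg (d s u))))

-- An upper bound for the size of cuts.

AllPairs-lookup : ∀ {A : Set} {R : A → A → Set} {xs} → AllPairs R xs → ∀ {i j} → i Fin.< j →
    R (List.lookup xs i) (List.lookup xs j)
AllPairs-lookup (rs ∷ _)  {zero}  {suc j} _          = All.lookup rs (∈-lookup j)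
AllPairs-lookup (_ ∷ rss) {suc i} {suc j} (ℕ.s≤s lt) = AllPairs-lookup rss lt

-- A point of Cut_s^r is determined by the lower end v of its edge, and the edge
-- contains a point at distance r only if d s u < r ≤ d s v, with u the parent of v.
cut-bound : ∀ C → let open CertifiedGraph C in ∀ {c} (key : V → V → Fin c) →
  (∀ s {u v u′ v′} → Child s u v → Child s u′ v′ → RootedTree.Significant C s u v → RootedTree.Significant C s u′ v′ →
   key s v ≡ key s v′ → v ≡ v′ ⊎ d s v ℕ.≤ d s u′ ⊎ d s v′ ℕ.≤ d s u) →
  ∀ {k} → CutSize (Certified.graph C) k → k ℕ.≤ c
cut-bound C {c} key separated (s , r , _ , xs , refl , cuts , distinct , _) = Fin.injective⇒≤ f-injective
  where
  open CertifiedGraph C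
  open Certified C
  open RootedTree C s
  open Skeleton graph s

  cut : ∀ i → InCut r (List.lookup xs i)
  cut i = All.lookup cuts (∈-lookup i)

  -- Pigeonhole: each point of the cut is sent to the key of the far end of its edge, and equal keys
  -- will force equal points.
  f : Fin (List.length xs) → Fin c
  f i = key s (proj₁ (height (List.lookup xs i)))

  same : ∀ {x y v v′ t t′} → InCut r x → InCut r y → Height x v t → Height y v′ t′ → key s v ≡ key s v′ → x ≈ y
  same {x} {y} {v} {v′} {t} {t′} cx cy h k eq = by-parents (height-parent h) (height-parent k)
    where
    t≡t′ : t ≡ t′
    t≡t′ = trans (cut-height cx h) (sym (cut-height cy k))

    by-separation : ∀ {u u′} → D s u ℚ.< t → D s u′ ℚ.< t′ → v ≡ v′ ⊎ d s v ℕ.≤ d s u′ ⊎ d s v′ ℕ.≤ d s u → x ≈ y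
    by-separation lt lt′ (inj₁ refl)      = height-injective h k t≡t′
    -- The edge of `x` ends no farther out than `u′`, while `y`, at the same distance, lies strictly
    -- beyond `u′`.
    by-separation lt lt′ (inj₂ (inj₁ le)) =
        ⊥-elim (ℚ.<-irrefl t≡t′ (ℚ.≤-<-trans (height-≤ h) (ℚ.≤-<-trans (ι-mono-≤ le) lt′)))
    by-separation lt lt′ (inj₂ (inj₂ le)) =
        ⊥-elim (ℚ.<-irrefl (sym t≡t′) (ℚ.≤-<-trans (height-≤ k) (ℚ.≤-<-trans (ι-mono-≤ le) lt)))

    ¬below-0 : ∀ {u t} → t ≡ 0ℚ → ¬ D s u ℚ.< t
    ¬below-0 {u} refl lt = ℚ.<-irrefl refl (ℚ.≤-<-trans (ι-nonNeg (d s u)) lt)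

    by-parents : (v ≡ s × t ≡ 0ℚ) ⊎ (∃ λ u → Child s u v × D s u ℚ.< t) →
                 (v′ ≡ s × t′ ≡ 0ℚ) ⊎ (∃ λ u → Child s u v′ × D s u ℚ.< t′) → x ≈ y
    by-parents (inj₁ (refl , _)) (inj₁ (refl , _)) = height-injective h k t≡t′
    by-parents (inj₁ (_ , t≡0)) (inj₂ (_ , _ , lt)) = ⊥-elim (¬below-0 (trans (sym t≡t′) t≡0) lt)
    by-parents (inj₂ (_ , _ , lt)) (inj₁ (_ , t′≡0)) = ⊥-elim (¬below-0 (trans t≡t′ t′≡0) lt)
    by-parents (inj₂ (_ , a , lt)) (inj₂ (_ , a′ , lt′)) =
      by-separation lt lt′ (separated s a a′ (significant (proj₁ cx) h lt) (significant (proj₁ cy) k lt′) eq)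

  f-injective : ∀ {i j} → f i ≡ f j → i ≡ j
  f-injective {i} {j} eq with Fin.<-cmp i j
  ... | tri≈ _ i≡j _ = i≡j
  ... | tri< i<j _ _ = ⊥-elim (AllPairs-lookup distinct i<j
      (same (cut i) (cut j) (proj₂ (proj₂ (height _))) (proj₂ (proj₂ (height _))) eq))
  ... | tri> _ _ j<i = ⊥-elim (AllPairs-lookup distinct j<i
      (same (cut j) (cut i) (proj₂ (proj₂ (height _))) (proj₂ (proj₂ (height _))) (sym eq)))

-- Existence of extremal values, and unboundedness from a family of graphs.

¬¬least : ∀ {P : ℕ → Set} {k} → P k → ¬ ¬ ∃ (IsLeast P)
¬¬least {P} {k} p none = <-rec (λ k → ¬ P k) (λ k rec p → none (k , p , λ m pm → ℕ.≮⇒≥ λ m<k → rec m<k pm)) k p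

-- `P` is not assumed decidable, hence the double negation. The induction runs on the distance
-- `c ∸ k` to the bound, which shrinks when `k` is replaced by a larger value.
¬¬greatest : ∀ {P : ℕ → Set} {k} c → (∀ {m} → P m → m ℕ.≤ c) → P k → ¬ ¬ ∃ (IsGreatest P)
¬¬greatest {P} {k} c bound p none = <-rec (λ n → ∀ k → c ℕ.∸ k ≡ n → ¬ P k) step (c ℕ.∸ k) k refl p
  where
  step : ∀ n → (∀ {m} → m ℕ.< n → ∀ k → c ℕ.∸ k ≡ m → ¬ P k) → ∀ k → c ℕ.∸ k ≡ n → ¬ P k
  step _ rec k refl p = none (k , p , λ m pm → ℕ.≮⇒≥ λ k<m → rec (ℕ.∸-monoʳ-< k<m (bound pm)) m refl pm)

-- Double negation suffices for the existence of the parameter values, because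
-- unboundedness is a negative statement.
unbounded : ∀ {p q : Parameter} (G : ℕ → Graph) c →
  (∀ n → ¬ ¬ ∃ (p (G n))) → (∀ n → ¬ ¬ ∃ (q (G n))) →
  (∀ n {a} → p (G n) a → n ℕ.≤ a) → (∀ n {b} → q (G n) b → b ℕ.≤ c) → ¬ ∃ (BoundedBy p q)
unbounded G c p-exists q-exists large small (f , bounded) =
  p-exists n λ (a , pa) → q-exists n λ (b , qb) →
    ℕ.<-irrefl refl (ℕ.≤-trans (large n pa) (ℕ.≤-trans (bounded (G n) pa qb) (f≤max c (small n qb))))
  where
  -- `f` need not be monotone, so its maximum over `0, …, c` is taken; the graph with the next index
  -- contradicts the bound.
  max : ℕ → ℕ
  max zero    = f 0
  max (suc c) = max c ℕ.⊔ f (suc c)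

  n : ℕ
  n = suc (max c)

  f≤max : ∀ c {b} → b ℕ.≤ c → f b ℕ.≤ max c
  f≤max zero    ℕ.z≤n = ℕ.≤-refl
  f≤max (suc c) {b} b≤ with ℕ.m≤n⇒m<n∨m≡n b≤
  ... | inj₁ (ℕ.s≤s b≤c) = ℕ.≤-trans (f≤max c b≤c) (ℕ.m≤m⊔n (max c) (f (suc c)))
  ... | inj₂ refl        = ℕ.m≤n⊔m (max c) (f (suc c))

-- The star: highway dimensions at most 1, large skeleton dimension.

module UnitStar (n : ℕ) where

  Adj : Fin (suc n) → Fin (suc n) → Set
  Adj zero    (suc _) = ⊤
  Adj (suc _) zero    = ⊤
  Adj _       _       = ⊥

  d : Fin (suc n) → Fin (suc n) → ℕ
  d zero    zero    = 0
  d zero    (suc _) = 1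
  d (suc _) zero    = 1
  d (suc i) (suc j) with i Fin.≟ j
  ... | yes _ = 0
  ... | no  _ = 2

  d-self : ∀ s → d s s ≡ 0
  d-self zero = refl
  d-self (suc i) with i Fin.≟ i
  ... | yes _  = refl
  ... | no i≢i = contradiction refl i≢i

  d-sym : ∀ u v → d u v ≡ d v u
  d-sym zero    zero    = refl
  d-sym zero    (suc _) = refl
  d-sym (suc _) zero    = refl
  d-sym (suc i) (suc j) with i Fin.≟ j | j Fin.≟ i
  ... | yes _    | yes _  = refl
  ... | no _     | no _   = refl
  ... | yes refl | no j≢j = contradiction refl j≢j
  ... | no i≢i   | yes refl = contradiction refl i≢i

  d-lip : ∀ s {u v} → Adj u v → d s v ℕ.≤ d s u ℕ.+ 1
  d-lip zero {zero}  {suc _} _ = ℕ.≤-refl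
  d-lip zero {suc _} {zero}  _ = ℕ.z≤n
  d-lip (suc i) {suc j} {zero} _ = ℕ.m≤n+m 1 (d (suc i) (suc j))
  d-lip (suc i) {zero} {suc j} _ with i Fin.≟ j
  ... | yes _ = ℕ.z≤n
  ... | no  _ = ℕ.≤-refl

  Child : Fin (suc n) → Fin (suc n) → Fin (suc n) → Set
  Child s u v = Adj u v × d s v ≡ d s u ℕ.+ 1

  parent : ∀ s v → s ≡ v ⊎ ∃ λ u → Child s u v
  parent zero    zero    = inj₁ refl
  parent zero    (suc j) = inj₂ (zero , tt , refl)
  parent (suc i) zero    = inj₂ (suc i , tt , cong (ℕ._+ 1) (sym (d-self (suc i))))
  parent (suc i) (suc j) with i Fin.≟ j
  ... | yes refl = inj₁ refl
  ... | no  _    = inj₂ (zero , tt , refl)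

  parent-unique : ∀ s {u u′ v} → Child s u v → Child s u′ v → u ≡ u′
  parent-unique s {zero}  {zero}  {suc _} _ _ = refl
  parent-unique zero {suc _} {suc _} {zero} (_ , ()) _
  parent-unique (suc i) {suc j} {suc k} {zero} (_ , p) (_ , q) with i Fin.≟ j | i Fin.≟ k
  ... | yes refl | yes refl = refl

  adj? : ∀ u v → Dec (Adj u v)
  adj? zero    zero    = no λ ()
  adj? zero    (suc _) = yes tt
  adj? (suc _) zero    = yes tt
  adj? (suc _) (suc _) = no λ ()

  adj-sym : ∀ {u v} → Adj u v → Adj v u
  adj-sym {zero}  {suc _} _ = tt
  adj-sym {suc _} {zero}  _ = tt

  irrefl : ∀ {u} → ¬ Adj u u
  irrefl {zero}  ()
  irrefl {suc _} ()

  certified : CertifiedGraph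
  certified = record
    { V = Fin (suc n) ; order = suc n ; finite = ↔-id _ ; nonEmpty = _ ; Adj = Adj ; irrefl = λ {u} → irrefl {u}
    ; adj-sym = λ {u} {v} → adj-sym {u} {v} ; adj? = adj?
    ; len = λ _ _ → 1 ; len-sym = λ _ → refl ; len-pos = λ _ → ℕ.≤-refl
    ; d = d ; d-self = d-self ; d-sym = d-sym ; d-lip = λ s {u} {v} → d-lip s {u} {v}
    ; parent = parent ; parent-unique = λ s {u} {u′} {v} → parent-unique s {u} {u′} {v} }

  open Certified certified hiding (D)
  open Graph graph using (Path; []; _∷_; ∥_∥; nodes; IsShortest; InBall)
  module R = RootedTree certified zero
  open Skeleton graph zero

  -- Positive length means that the path has an edge, and every edge of the star contains the
  -- centre.
  centre∈nodes : ∀ {a b} (π : Path a b) → 0ℚ ℚ.< ∥ π ∥ → zero ∈ nodes π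
  centre∈nodes []              lt = ⊥-elim (ℚ.<-irrefl refl lt)
  centre∈nodes {zero}  (_ ∷ _) _  = here refl
  centre∈nodes {suc _} (_∷_ {v = zero} _ π) _ = there (head∈nodes π)

  HD₁≤1 : HD₁ graph 1
  HD₁≤1 r 0<r u with Certified.D certified u zero ℚ.≤? + 4 ℚ./ 1 ℚ.* r
  ... | yes p =
      zero ∷ [] , inBall p ∷ [] , ℕ.≤-refl , λ π _ lt _ → zero , here refl , centre∈nodes π (ℚ.<-trans 0<r lt)
  -- If the centre is outside the ball, no path of positive length lies inside it and the empty set
  -- suffices.
  ... | no ¬p = [] , [] , ℕ.z≤n , λ π _ lt inside → ⊥-elim
      (¬p (inBall⁻¹ (All.lookup inside (centre∈nodes π (ℚ.<-trans 0<r lt)))))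

  HD₂≤1 : HD₂ graph 1
  HD₂≤1 r 0<r u = zero ∷ [] , ℕ.≤-refl , λ π _ lt _ _ → zero , here refl , centre∈nodes π (ℚ.<-trans 0<r lt)

  ½<ℓ : ½ ℚ.< ι 1
  ½<ℓ = subst (½ ℚ.<_) (sym (ι-numeral 1)) (toWitness {a? = ½ ℚ.<? + 1 ℚ./ 1} _)

  edge : ∀ i → WeightedGraph.Adj R.T zero (suc i)
  edge i = suc i , tt ∷ [] , tight⇒shortest (tt ∷ []) (ℚ.+-identityʳ (ι 1)) , inj₁ Paths.here

  midpoint : Fin n → Point
  midpoint i = inner (edge i) ½ (ℚ.positive⁻¹ ½) ½<ℓ

  midpoint-height : ∀ i → R.Height (midpoint i) (suc i) ½
  midpoint-height i =
      subst (R.Height (midpoint i) (suc i)) (trans (cong (ℚ._+ ½) ι-0) (ℚ.+-identityˡ ½)) (R.inner fwd (tt , refl))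

  -- The height 1 is written as `½ ℚ.+ ½`, the form `a + b` in which `Descendant` asks for it.
  leaf-height : ∀ i → R.Height (node (suc i)) (suc i) (½ ℚ.+ ½)
  leaf-height i = subst (R.Height (node (suc i)) (suc i)) (ι-numeral 1) R.node

  midpoint-leaf : ∀ i → IsDist~ (midpoint i) (node (suc i)) ½
  midpoint-leaf i = subst (Route (midpoint i) (node (suc i))) eq (via (inner bwd) Paths.[] node)
                  , λ {c} ρ → ≤-by (R.route-lip ρ (midpoint-height i) (leaf-height i)) (ring c)
    where
    eq : ι 1 ℚ.- ½ ℚ.+ 0ℚ ℚ.+ 0ℚ ≡ ½
    eq = cong (λ x → x ℚ.- ½ ℚ.+ 0ℚ ℚ.+ 0ℚ) (ι-numeral 1)

    ring : ∀ c → c ℚ.+ (½ ℚ.+ ½) ≡ ½ ℚ.+ (½ ℚ.+ c)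
    ring = solve-∀ ℚ-ring

  midpoint-cut : ∀ i → InCut ½ (midpoint i)
  -- The leaf lies ½ beyond the midpoint, where ¼ is required.
  midpoint-cut i = (node (suc i) , (½ , ½ , root-mid , midpoint-leaf i , R.height-IsDist (leaf-height i)) ,
                    ½ , ½ , root-mid , midpoint-leaf i , toWitness {a? = ½ ℚ.* ½ ℚ.≤? ½} _) , root-mid
    where
    root-mid : IsDist~ (node zero) (midpoint i) ½
    root-mid = R.height-IsDist (midpoint-height i)

  midpoint-injective : ∀ {i j} → midpoint i ≈ midpoint j → i ≡ j
  midpoint-injective (inner≈ fwd fwd) = refl
  midpoint-injective (inner≈ bwd bwd) = refl

  -- The list must exhaust the cut: with far end `suc i` the height ½ leaves only the midpoint, and
  -- the centre has height 0.
  midpoints : ∀ {x v t} → InCut ½ x → R.Height x v t → Any (x ≈_) (List.tabulate midpoint)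
  midpoints {v = suc i} c h = Any.tabulate⁺ i (R.height-injective h (midpoint-height i) (R.cut-height c h))
  midpoints {v = zero} c h =
    ⊥-elim (ℚ.<-irrefl refl (ℚ.<-≤-trans (ℚ.positive⁻¹ ½) (subst₂ ℚ._≤_ (R.cut-height c h) ι-0 (R.height-≤ h))))

  cut-size : CutSize graph n
  cut-size = zero , ½ , toWitness {a? = 0ℚ ℚ.≤? ½} _ , List.tabulate midpoint , length-tabulate midpoint ,
    All.tabulate⁺ midpoint-cut , AllPairs.tabulate⁺ (λ i≢j → i≢j ∘ midpoint-injective) ,
    λ x c → midpoints c (proj₂ (proj₂ (R.height x)))

  -- Taking the far end itself as key gives the crude bound `suc n`, enough for a maximum to exist.
  κ-exists : ¬ ¬ ∃ (κ graph)
  κ-exists = ¬¬greatest (suc n) (cut-bound certified (λ _ v → v) (λ _ _ _ _ _ eq → inj₁ eq)) cut-size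

-- Distances along a line.

ℕ-≤-by : ∀ {p q a b} → p ℕ.≤ q → b ℕ.+ p ≡ a ℕ.+ q → a ℕ.≤ b
ℕ-≤-by {p} {q} {a} {b} p≤q eq = ℕ.≮⇒≥ λ b<a → ℕ.<-irrefl eq (ℕ.+-mono-<-≤ b<a p≤q)

-- Distance from `m` grows on moving away from `m`, so two neighbours of a point are never both
-- nearer to `m`. This makes parents along the spine unique.
no-local-max : ∀ m i → ¬ (ℕ.∣ m - suc i ∣ ≡ ℕ.∣ m - i ∣ ℕ.+ 1 × ℕ.∣ m - suc i ∣ ≡ ℕ.∣ m - suc (suc i) ∣ ℕ.+ 1)
no-local-max zero    i       (_ , q) = ℕ.m≢1+m+n (suc i) q
no-local-max (suc m) zero    (p , _) = ℕ.m≢1+m+n m (trans (sym (ℕ.∣-∣-identityʳ m)) p)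
no-local-max (suc m) (suc i) pq      = no-local-max m i pq

consecutive : ∀ i j → ℕ.∣ i - j ∣ ≡ 1 → j ≡ suc i ⊎ i ≡ suc j
consecutive zero    j       p = inj₁ p
consecutive (suc i) zero    p = inj₂ p
consecutive (suc i) (suc j) p = [ inj₁ ∘ cong suc , inj₂ ∘ cong suc ]′ (consecutive i j p)

step-unique : ∀ m i i′ j → ℕ.∣ i - j ∣ ≡ 1 → ℕ.∣ i′ - j ∣ ≡ 1 →
              ℕ.∣ m - j ∣ ≡ ℕ.∣ m - i ∣ ℕ.+ 1 → ℕ.∣ m - j ∣ ≡ ℕ.∣ m - i′ ∣ ℕ.+ 1 → i ≡ i′
step-unique m i i′ j p p′ q q′ with consecutive i j p | consecutive i′ j p′
... | inj₁ refl | inj₁ eq   = ℕ.suc-injective eq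
... | inj₂ refl | inj₂ refl = refl
... | inj₁ refl | inj₂ refl = ⊥-elim (no-local-max m i (q , q′))
... | inj₂ refl | inj₁ refl = ⊥-elim (no-local-max m i′ (q′ , q))

gap : ∀ {n} → Fin n → Fin n → ℕ
gap i j = ℕ.∣ toℕ i - toℕ j ∣

gap-self : ∀ {n} (i : Fin n) → gap i i ≡ 0
gap-self i = ℕ.∣n-n∣≡0 (toℕ i)

gap-0 : ∀ {n} {i j : Fin n} → gap i j ≡ 0 → i ≡ j
gap-0 p = Fin.toℕ-injective (ℕ.∣m-n∣≡0⇒m≡n p)

gap-sym : ∀ {n} (i j : Fin n) → gap i j ≡ gap j i
gap-sym i j = ℕ.∣-∣-comm (toℕ i) (toℕ j)

gap-triangle : ∀ {n} (i j k : Fin n) → gap i k ℕ.≤ gap i j ℕ.+ gap j k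
gap-triangle i j k = ℕ.∣-∣-triangle (toℕ i) (toℕ j) (toℕ k)

towards : ∀ {n} (m j : Fin n) → m ≡ j ⊎ ∃ λ i → gap i j ≡ 1 × gap m j ≡ gap m i ℕ.+ 1
towards zero    zero    = inj₁ refl
towards zero    (suc j) =
    inj₂ (Fin.inject₁ j , below , trans (ℕ.+-comm 1 (toℕ j)) (cong (ℕ._+ 1) (sym (Fin.toℕ-inject₁ j))))
  where
  below : ℕ.∣ toℕ (Fin.inject₁ j) - suc (toℕ j) ∣ ≡ 1
  below rewrite Fin.toℕ-inject₁ j = ∣n-1+n∣≡1 (toℕ j)
    where
    ∣n-1+n∣≡1 : ∀ n → ℕ.∣ n - suc n ∣ ≡ 1
    ∣n-1+n∣≡1 zero    = refl
    ∣n-1+n∣≡1 (suc n) = ∣n-1+n∣≡1 n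
towards (suc zero)    zero = inj₂ (suc zero , refl , refl)
towards (suc (suc m)) zero = inj₂ (suc zero , refl , cong suc (ℕ.+-comm 1 (toℕ m)))
towards (suc m) (suc j) with towards m j
... | inj₁ refl = inj₁ refl
... | inj₂ (i , p , q) = inj₂ (suc i , p , q)

side : ∀ {n} → Fin n → Fin n → Fin 2
side i j with toℕ i ℕ.≤? toℕ j
... | yes _ = zero
... | no  _ = suc zero

-- On each side of `m` the gap is a difference with one end fixed, which can be cancelled.
same-side : ∀ {n} (m : Fin n) {i j} → side m i ≡ side m j → gap m i ≡ gap m j → i ≡ j
same-side m {i} {j} p q with toℕ m ℕ.≤? toℕ i | toℕ m ℕ.≤? toℕ j
... | yes a | yes b =
    Fin.toℕ-injective (ℕ.∸-cancelʳ-≡ a b (trans (sym (ℕ.m≤n⇒∣m-n∣≡n∸m a)) (trans q (ℕ.m≤n⇒∣m-n∣≡n∸m b))))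
... | no a  | no b  =
    Fin.toℕ-injective (ℕ.∸-cancelˡ-≡ a′ b′ (trans (sym (ℕ.m≤n⇒∣n-m∣≡n∸m a′)) (trans q (ℕ.m≤n⇒∣n-m∣≡n∸m b′))))
  where
  a′ = ℕ.≰⇒≥ a
  b′ = ℕ.≰⇒≥ b

-- The comb with rungs and its shortest path trees.

-- The detour of a rung has length 4n + 4, so the rung saves 1: too little to climb
-- a tooth of length 2 for it.
module Comb (n-1 : ℕ) where

  -- A successor, so that a rung joins two different tips; the comb with parameter `k` has `k + 1`
  -- rungs.
  n N : ℕ
  n = suc n-1
  N = n ℕ.+ n

  V : Set
  V = Fin N ⊎ Fin N

  pattern spine i = inj₁ i
  pattern tip i = inj₂ i

  Adj : V → V → Set
  Adj (spine i) (spine j) = gap i j ≡ 1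
  Adj (spine i) (tip j)   = i ≡ j
  Adj (tip i)   (spine j) = i ≡ j
  Adj (tip i)   (tip j)   = gap i j ≡ n

  rung : ℕ
  rung = 4 ℕ.* n ℕ.+ 3

  len : V → V → ℕ
  len (spine _) (spine _) = 4
  len (spine _) (tip _)   = 2
  len (tip _)   (spine _) = 2
  len (tip _)   (tip _)   = rung

  -- The distance between two tips as a function of their gap `k`: over their rung if `k` is `n`,
  -- else `2 + 4k + 2` along the spine.
  tips : ℕ → ℕ
  tips zero = 0
  tips k@(suc _) with k ℕ.≟ n
  ... | yes _ = rung
  ... | no  _ = 4 ℕ.* k ℕ.+ 4

  data Tips (k : ℕ) : Set where
    same    : k ≡ 0 → tips k ≡ 0 → Tips k
    matched : k ≡ n → tips k ≡ rung → Tips k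
    far     : k ≢ 0 → k ≢ n → tips k ≡ 4 ℕ.* k ℕ.+ 4 → Tips k

  tips-view : ∀ k → Tips k
  tips-view zero = same refl refl
  tips-view k@(suc k-1) with k ℕ.≟ n in eq
  ... | yes p = matched p (lemma eq)
    where
    lemma : ∀ {p} → (k ℕ.≟ n) ≡ yes p → tips k ≡ rung
    lemma eq rewrite eq = refl
  ... | no ¬p = far (λ ()) ¬p (lemma eq)
    where
    lemma : ∀ {p} → (k ℕ.≟ n) ≡ no p → tips k ≡ 4 ℕ.* k ℕ.+ 4
    lemma eq rewrite eq = refl

  tips-≤ : ∀ k → tips k ℕ.≤ 4 ℕ.* k ℕ.+ 4
  tips-≤ k with tips-view k
  ... | same _ eq       = subst (ℕ._≤ _) (sym eq) ℕ.z≤n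
  ... | matched refl eq = subst (ℕ._≤ 4 ℕ.* n ℕ.+ 4) (sym eq) (ℕ.+-monoʳ-≤ (4 ℕ.* n) (ℕ.n≤1+n 3))
  ... | far _ _ eq      = ℕ.≤-reflexive eq

  tips-≥ : ∀ k → k ≢ 0 → 4 ℕ.* k ℕ.+ 3 ℕ.≤ tips k
  tips-≥ k k≢0 with tips-view k
  ... | same eq _       = contradiction eq k≢0
  ... | matched refl eq = ℕ.≤-reflexive (sym eq)
  ... | far _ _ eq      = subst (4 ℕ.* k ℕ.+ 3 ℕ.≤_) (sym eq) (ℕ.+-monoʳ-≤ (4 ℕ.* k) (ℕ.n≤1+n 3))

  tips-n : tips n ≡ rung
  tips-n with tips-view n
  ... | matched _ eq = eq
  ... | far _ n≢n _  = contradiction refl n≢n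

  d : V → V → ℕ
  d (spine i) (spine j) = 4 ℕ.* gap i j
  d (spine i) (tip j)   = 4 ℕ.* gap i j ℕ.+ 2
  d (tip i)   (spine j) = 4 ℕ.* gap i j ℕ.+ 2
  d (tip i)   (tip j)   = tips (gap i j)

  scale : ∀ {a b c} → a ℕ.≤ b ℕ.+ c → 4 ℕ.* a ℕ.≤ 4 ℕ.* b ℕ.+ 4 ℕ.* c
  scale {a} {b} {c} p = subst (4 ℕ.* a ℕ.≤_) (ℕ.*-distribˡ-+ 4 b c) (ℕ.*-monoʳ-≤ 4 p)

  scaled-step : ∀ (m i j : Fin N) {c} → gap i j ≡ c → 4 ℕ.* gap m j ℕ.≤ 4 ℕ.* gap m i ℕ.+ 4 ℕ.* c
  scaled-step m i j refl = scale {gap m j} {gap m i} (gap-triangle m i j)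

  -- By the triangle inequality the spine covers the gap `n` at cost at most `4n`, while the rung
  -- costs `4n + 3` and is entered only after climbing a tooth. With `tip-rung-strict`, a rung can
  -- be tight only when it starts at the root.
  spine-rung-strict : ∀ (m i j : Fin N) → gap i j ≡ n → 4 ℕ.* gap m j ℕ.+ 2 ℕ.< (4 ℕ.* gap m i ℕ.+ 2) ℕ.+ rung
  spine-rung-strict m i j p =
      ℕ-≤-by (ℕ.+-mono-≤ (scaled-step m i j p) (ℕ.z≤n {2})) (ring (4 ℕ.* gap m j) (4 ℕ.* gap m i) (4 ℕ.* n))
    where
    ring : ∀ a b c → ((b ℕ.+ 2) ℕ.+ (c ℕ.+ 3)) ℕ.+ (a ℕ.+ 0) ≡ suc (a ℕ.+ 2) ℕ.+ ((b ℕ.+ c) ℕ.+ 2)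
    ring = ℕ-Solver.solve-∀

  tip-rung-strict : ∀ (m i j : Fin N) → gap i j ≡ n → gap m i ≢ 0 → tips (gap m j) ℕ.< tips (gap m i) ℕ.+ rung
  tip-rung-strict m i j p ≢0 = ℕ-≤-by (ℕ.+-mono-≤ (ℕ.+-mono-≤ (tips-≤ (gap m j)) (tips-≥ (gap m i) ≢0))
      (ℕ.+-mono-≤ (scaled-step m i j p) (ℕ.z≤n {1})))
    (ring (tips (gap m j)) (tips (gap m i)) (4 ℕ.* gap m j) (4 ℕ.* gap m i) (4 ℕ.* n))
    where
    ring : ∀ s t a b c → (t ℕ.+ (c ℕ.+ 3)) ℕ.+ ((s ℕ.+ (b ℕ.+ 3)) ℕ.+ (a ℕ.+ 0)) ≡
        suc s ℕ.+ (((a ℕ.+ 4) ℕ.+ t) ℕ.+ ((b ℕ.+ c) ℕ.+ 1))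
    ring = ℕ-Solver.solve-∀

  4k+2≤tips+2 : ∀ k → 4 ℕ.* k ℕ.+ 2 ℕ.≤ tips k ℕ.+ 2
  4k+2≤tips+2 zero        = ℕ.≤-refl
  4k+2≤tips+2 k@(suc k-1) = ℕ.+-monoˡ-≤ 2 (ℕ.≤-trans (ℕ.m≤m+n (4 ℕ.* k) 3) (tips-≥ k λ ()))

  d-lip : ∀ s {u v} → Adj u v → d s v ℕ.≤ d s u ℕ.+ len u v
  d-lip (spine m) {spine i} {spine j} p = scaled-step m i j p
  d-lip (spine m) {spine i} {tip i} refl = ℕ.≤-refl
  d-lip (spine m) {tip i} {spine i} refl = ℕ.≤-trans (ℕ.m≤m+n _ 2) (ℕ.m≤m+n _ 2)
  d-lip (spine m) {tip i} {tip j} p = ℕ.<⇒≤ (spine-rung-strict m i j p)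
  d-lip (tip m) {spine i} {spine j} p = ℕ-≤-by (scaled-step m i j p) (ring (4 ℕ.* gap m j) (4 ℕ.* gap m i))
    where
    ring : ∀ a b → ((b ℕ.+ 2) ℕ.+ 4) ℕ.+ a ≡ (a ℕ.+ 2) ℕ.+ (b ℕ.+ 4)
    ring = ℕ-Solver.solve-∀
  d-lip (tip m) {spine i} {tip i} refl =
      ℕ.≤-trans (tips-≤ (gap m i)) (ℕ.≤-reflexive (sym (ℕ.+-assoc (4 ℕ.* gap m i) 2 2)))
  d-lip (tip m) {tip i} {spine i} refl = 4k+2≤tips+2 (gap m i)
  d-lip (tip m) {tip i} {tip j} p with gap m i ℕ.≟ 0
  ... | no ≢0 = ℕ.<⇒≤ (tip-rung-strict m i j p ≢0)
  ... | yes ≡0 with refl ← gap-0 {i = m} {i} ≡0 = ℕ.≤-trans (ℕ.≤-reflexive (trans (cong tips p) tips-n))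
      (ℕ.m≤n+m rung (tips (gap m m)))

  Child : V → V → V → Set
  Child s u v = Adj u v × d s v ≡ d s u ℕ.+ len u v

  position : V → Fin N
  position (spine i) = i
  position (tip i)   = i

  -- The shape of all `Child` edges. A rung occurs only as `cross`, leaving the root; other teeth
  -- are reached from their base, by `sprout` or `detour` according to the kind of the root.
  data Tight : V → V → V → Set where
    along  : ∀ {s i j} → gap i j ≡ 1 → gap (position s) j ≡ gap (position s) i ℕ.+ 1 → Tight s (spine i) (spine j)
    sprout : ∀ {m j : Fin N} → Tight (spine m) (spine j) (tip j)
    detour : ∀ {m j : Fin N} → gap m j ≢ 0 → gap m j ≢ n → Tight (tip m) (spine j) (tip j)
    foot   : ∀ {m} → Tight (tip m) (tip m) (spine m)
    cross  : ∀ {m j : Fin N} → gap m j ≡ n → Tight (tip m) (tip m) (tip j)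

  unscale : ∀ {a b} → 4 ℕ.* a ≡ 4 ℕ.* b ℕ.+ 4 → a ≡ b ℕ.+ 1
  unscale {a} {b} eq = ℕ.*-cancelˡ-≡ a (b ℕ.+ 1) 4 (trans eq (sym (ℕ.*-distribˡ-+ 4 b 1)))

  tight : ∀ s u v → Child s u v → Tight s u v
  tight (spine m) (spine i) (spine j) (p , eq) = along p (unscale {gap m j} {gap m i} eq)
  tight (spine m) (spine i) (tip i) (refl , eq) = sprout
  tight (spine m) (tip i) (spine i) (refl , eq) = ⊥-elim (ℕ.m≢1+m+n (4 ℕ.* gap m i) (trans eq (ring (4 ℕ.* gap m i))))
    where
    ring : ∀ a → (a ℕ.+ 2) ℕ.+ 2 ≡ suc (a ℕ.+ 3)
    ring = ℕ-Solver.solve-∀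
  tight (spine m) (tip i) (tip j) (p , eq) = ⊥-elim (ℕ.<-irrefl eq (spine-rung-strict m i j p))
  tight (tip m) (spine i) (spine j) (p , eq) =
      along p (unscale {gap m j} {gap m i} (ℕ.+-cancelʳ-≡ 2 _ _ (trans eq (ring (4 ℕ.* gap m i)))))
    where
    ring : ∀ b → (b ℕ.+ 2) ℕ.+ 4 ≡ (b ℕ.+ 4) ℕ.+ 2
    ring = ℕ-Solver.solve-∀
  tight (tip m) (spine i) (tip i) (refl , eq) with tips-view (gap m i)
  ... | same _ eq′ = ⊥-elim (ℕ.m≢1+m+n 0 (trans (sym eq′) (trans eq (ring (4 ℕ.* gap m i)))))
    where
    ring : ∀ a → (a ℕ.+ 2) ℕ.+ 2 ≡ suc (a ℕ.+ 3)
    ring = ℕ-Solver.solve-∀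
  -- Along the spine the matched tip would be at `4n + 4`, one more than over the rung.
  ... | matched p eq′ = ⊥-elim (ℕ.m≢1+m+n rung (trans (sym eq′)
      (trans eq (trans (cong (λ k → (4 ℕ.* k ℕ.+ 2) ℕ.+ 2) p) (ring (4 ℕ.* n))))))
    where
    ring : ∀ a → (a ℕ.+ 2) ℕ.+ 2 ≡ suc ((a ℕ.+ 3) ℕ.+ 0)
    ring = ℕ-Solver.solve-∀
  ... | far p q _ = detour p q
  tight (tip m) (tip i) (spine i) (refl , eq) with gap m i ℕ.≟ 0
  ... | yes ≡0 with refl ← gap-0 {i = m} {i} ≡0 = foot
  ... | no ≢0 = ⊥-elim (ℕ.<-irrefl eq (ℕ.≤-trans (ℕ.≤-reflexive (sym (ℕ.+-suc (4 ℕ.* gap m i) 2)))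
      (ℕ.≤-trans (tips-≥ (gap m i) ≢0) (ℕ.m≤m+n _ 2))))
  tight (tip m) (tip i) (tip j) (p , eq) with gap m i ℕ.≟ 0
  ... | yes ≡0 with refl ← gap-0 {i = m} {i} ≡0 = cross p
  ... | no ≢0 = ⊥-elim (ℕ.<-irrefl eq (tip-rung-strict m i j p ≢0))

  parent : ∀ s v → s ≡ v ⊎ ∃ λ u → Child s u v
  parent (spine m) (spine j) with towards m j
  ... | inj₁ refl = inj₁ refl
  ... | inj₂ (i , p , q) = inj₂ (spine i , p , trans (cong (4 ℕ.*_) q) (ℕ.*-distribˡ-+ 4 (gap m i) 1))
  parent (spine m) (tip j) = inj₂ (spine j , refl , refl)
  parent (tip m) (spine j) with towards m j
  ... | inj₁ refl = inj₂ (tip m , refl , trans (cong (λ k → 4 ℕ.* k ℕ.+ 2) (gap-self m))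
      (cong (λ k → tips k ℕ.+ 2) (sym (gap-self m))))
  ... | inj₂ (i , p , q) = inj₂ (spine i , p , trans (cong (λ k → 4 ℕ.* k ℕ.+ 2) q) (ring (gap m i)))
    where
    ring : ∀ a → 4 ℕ.* (a ℕ.+ 1) ℕ.+ 2 ≡ (4 ℕ.* a ℕ.+ 2) ℕ.+ 4
    ring = ℕ-Solver.solve-∀
  parent (tip m) (tip j) with tips-view (gap m j)
  ... | same p _     = inj₁ (cong tip (gap-0 p))
  ... | matched p eq = inj₂ (tip m , p , trans eq (cong (λ k → tips k ℕ.+ rung) (sym (gap-self m))))
  ... | far _ _ eq   = inj₂ (spine j , refl , trans eq (sym (ℕ.+-assoc (4 ℕ.* gap m j) 2 2)))

  -- Different rules never end at the same node: `along` ends at a positive gap from the root but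
  -- `foot` at gap 0, and `detour` excludes the gap `n` of `cross`.
  tight-unique : ∀ {s u u′ v} → Tight s u v → Tight s u′ v → u ≡ u′
  tight-unique {s} {spine i} {spine i′} {spine j} (along p q) (along p′ q′) =
    cong spine (Fin.toℕ-injective (step-unique (toℕ (position s)) (toℕ i) (toℕ i′) (toℕ j) p p′ q q′))
  tight-unique (along {i = i} {j} p q) foot =
    ⊥-elim (ℕ.m≢1+m+n 0 (trans (sym (gap-self j)) (trans q (ℕ.+-comm (gap j i) 1))))
  tight-unique foot (along {i = i} {j} p q) =
    ⊥-elim (ℕ.m≢1+m+n 0 (trans (sym (gap-self j)) (trans q (ℕ.+-comm (gap j i) 1))))
  tight-unique sprout       sprout       = refl
  tight-unique (detour _ _) (detour _ _) = refl
  tight-unique (detour _ q) (cross p)    = contradiction p q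
  tight-unique foot         foot         = refl
  tight-unique (cross p)    (detour _ q) = contradiction p q
  tight-unique (cross _)    (cross _)    = refl

  d-self : ∀ s → d s s ≡ 0
  d-self (spine i) = cong (4 ℕ.*_) (gap-self i)
  d-self (tip i)   = cong tips (gap-self i)

  d-sym : ∀ u v → d u v ≡ d v u
  d-sym (spine i) (spine j) = cong (4 ℕ.*_) (gap-sym i j)
  d-sym (spine i) (tip j)   = cong (λ k → 4 ℕ.* k ℕ.+ 2) (gap-sym i j)
  d-sym (tip i)   (spine j) = cong (λ k → 4 ℕ.* k ℕ.+ 2) (gap-sym i j)
  d-sym (tip i)   (tip j)   = cong tips (gap-sym i j)

  irrefl : ∀ {u} → ¬ Adj u u
  irrefl {spine i} p = ℕ.0≢1+n (trans (sym (gap-self i)) p)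
  irrefl {tip i}   p = ℕ.0≢1+n (trans (sym (gap-self i)) p)

  adj-sym : ∀ {u v} → Adj u v → Adj v u
  adj-sym {spine i} {spine j} p = trans (gap-sym j i) p
  adj-sym {spine _} {tip _}   p = sym p
  adj-sym {tip _}   {spine _} p = sym p
  adj-sym {tip i}   {tip j}   p = trans (gap-sym j i) p

  adj? : ∀ u v → Dec (Adj u v)
  adj? (spine i) (spine j) = gap i j ℕ.≟ 1
  adj? (spine i) (tip j)   = i Fin.≟ j
  adj? (tip i)   (spine j) = i Fin.≟ j
  adj? (tip i)   (tip j)   = gap i j ℕ.≟ n

  len-sym : ∀ u v → len u v ≡ len v u
  len-sym (spine _) (spine _) = refl
  len-sym (spine _) (tip _)   = refl
  len-sym (tip _)   (spine _) = refl
  len-sym (tip _)   (tip _)   = refl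

  len-pos : ∀ u v → 0 ℕ.< len u v
  len-pos (spine _) (spine _) = ℕ.z<s
  len-pos (spine _) (tip _)   = ℕ.z<s
  len-pos (tip _)   (spine _) = ℕ.z<s
  len-pos (tip _)   (tip _)   = ℕ.z<s

  certified : CertifiedGraph
  certified = record
    { V = V ; order = N ℕ.+ N ; finite = ↔-sym Fin.+↔⊎ ; nonEmpty = _ ; Adj = Adj ; irrefl = λ {u} → irrefl {u}
    ; adj-sym = λ {u} {v} → adj-sym {u} {v} ; adj? = adj?
    ; len = len ; len-sym = λ {u} {v} _ → len-sym u v ; len-pos = λ {u} {v} _ → len-pos u v
    ; d = d ; d-self = d-self ; d-sym = d-sym ; d-lip = λ s {u} {v} → d-lip s {u} {v}
    ; parent = parent ; parent-unique = λ s {u} {u′} {v} c c′ → tight-unique (tight s u v c) (tight s u′ v c′) }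

  open Certified certified using (graph; D; tight⇒shortest; inBall; head∈nodes; HD₁-exists; HD₂-exists)
  open Graph graph using (Path; []; _∷_; ∥_∥; nodes; IsShortest; InBall)

  -- The skeleton dimension of the comb.

  kind : V → Fin 2
  kind (spine _) = zero
  kind (tip _)   = suc zero

  -- Two kinds of nodes times two sides of the root: the source of the bound 4.
  key : V → V → Fin 4
  key s v = Fin.combine {2} {2} (kind v) (side (position s) (position v))

  len-spine-≤4 : ∀ u j → len u (spine j) ℕ.≤ 4
  len-spine-≤4 (spine _) j = ℕ.≤-refl
  len-spine-≤4 (tip _)   j = ℕ.m≤m+n 2 2

  d-spine-suc : ∀ s {i j} → gap (position s) i ℕ.< gap (position s) j → d s (spine i) ℕ.+ 4 ℕ.≤ d s (spine j)
  d-spine-suc (spine m) {i} {j} p =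
    ℕ.≤-trans (ℕ.≤-reflexive (trans (ℕ.+-comm _ 4) (sym (ℕ.*-suc 4 (gap m i))))) (ℕ.*-monoʳ-≤ 4 p)
  d-spine-suc (tip m) {i} {j} p = subst (ℕ._≤ d (tip m) (spine j)) (ring (gap m i)) (ℕ.+-monoˡ-≤ 2 (ℕ.*-monoʳ-≤ 4 p))
    where
    ring : ∀ a → 4 ℕ.* suc a ℕ.+ 2 ≡ (4 ℕ.* a ℕ.+ 2) ℕ.+ 4
    ring = ℕ-Solver.solve-∀

  -- Spine distances grow by at least 4 with the gap, and no edge into a spine node is longer than
  -- 4. So tree edges into spine nodes on one side occupy disjoint ranges of distance.
  nearer : ∀ s {i j u} → gap (position s) i ℕ.< gap (position s) j → Child s u (spine j) → d s (spine i) ℕ.≤ d s u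
  nearer s {i} {j} {u} p (_ , eq) =
    ℕ.+-cancelʳ-≤ 4 _ _ (ℕ.≤-trans (d-spine-suc s {i} {j} p)
        (ℕ.≤-trans (ℕ.≤-reflexive eq) (ℕ.+-monoʳ-≤ (d s u) (len-spine-≤4 u j))))

  open RootedTree using (Descends; Significant)

  tip-childless : ∀ {s j y} → tip j ≢ s → Descends certified s (tip j) y → y ≡ tip j
  tip-childless ≢s ε = refl
  tip-childless {s} {j} ≢s (_◅_ {j = w} c _) with tight s (tip j) w c
  ... | foot    = contradiction refl ≢s
  ... | cross _ = contradiction refl ≢s

  -- The only gap at which an edge into a tip can matter: the tooth of a spine root itself, or the
  -- rung of a tip root.
  tipGap : V → ℕ
  tipGap (spine _) = 0
  tipGap (tip _)   = n

  -- A tooth is at most half as long as the distance from the root to its base,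
  -- unless the root lies at that base.
  significant-tip : ∀ s {u j} → Child s u (tip j) → Significant certified s u (tip j) → gap (position s) j ≡ tipGap s
  significant-tip s {u} {j} c (y , desc , lt) with tight s u (tip j) c
  significant-tip (spine m) {j = j} c (y , desc , lt) | sprout with tip-childless {spine m} (λ ()) desc
  ... | refl = short (gap m j) lt
    where
    ring : ∀ a → suc ((4 ℕ.* suc a) ℕ.+ (4 ℕ.* suc a) ℕ.+ (4 ℕ.* suc a)) ≡
        ((4 ℕ.* suc a ℕ.+ 2) ℕ.+ (4 ℕ.* suc a ℕ.+ 2)) ℕ.+ suc (4 ℕ.* a)
    ring = ℕ-Solver.solve-∀

    -- This is `12k < 8k + 4`, which already fails at `k = 1`, there with equality.
    short : ∀ k → (4 ℕ.* k) ℕ.+ (4 ℕ.* k) ℕ.+ (4 ℕ.* k) ℕ.< (4 ℕ.* k ℕ.+ 2) ℕ.+ (4 ℕ.* k ℕ.+ 2) → k ≡ 0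
    short zero    _  = refl
    short (suc a) lt = ⊥-elim (ℕ.m+1+n≰m _ (subst (ℕ._≤ (4 ℕ.* suc a ℕ.+ 2) ℕ.+ (4 ℕ.* suc a ℕ.+ 2)) (ring a) lt))
  significant-tip (tip m) {j = j} c (y , desc , lt) | detour ≢0 _
    with tip-childless {tip m} (λ { refl → ≢0 (gap-self j) }) desc
  ... | refl = ⊥-elim (≢0 (short (gap m j) (ℕ.<-≤-trans lt (ℕ.+-mono-≤ (tips-≤ (gap m j)) (tips-≤ (gap m j))))))
    where
    ring : ∀ a → suc ((4 ℕ.* suc a ℕ.+ 2) ℕ.+ (4 ℕ.* suc a ℕ.+ 2) ℕ.+ (4 ℕ.* suc a ℕ.+ 2)) ≡
        ((4 ℕ.* suc a ℕ.+ 4) ℕ.+ (4 ℕ.* suc a ℕ.+ 4)) ℕ.+ suc (4 ℕ.* a ℕ.+ 2)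
    ring = ℕ-Solver.solve-∀

    -- Here `12k + 6 < 8k + 8`, again only for `k = 0`, the gap that `detour` excludes.
    short : ∀ k → (4 ℕ.* k ℕ.+ 2) ℕ.+ (4 ℕ.* k ℕ.+ 2) ℕ.+ (4 ℕ.* k ℕ.+ 2) ℕ.<
        (4 ℕ.* k ℕ.+ 4) ℕ.+ (4 ℕ.* k ℕ.+ 4) → k ≡ 0
    short zero    _  = refl
    short (suc a) lt = ⊥-elim (ℕ.m+1+n≰m _ (subst (ℕ._≤ (4 ℕ.* suc a ℕ.+ 4) ℕ.+ (4 ℕ.* suc a ℕ.+ 4)) (ring a) lt))
  significant-tip (tip m) c _ | cross p = p

  -- Spine nodes on one side are separated by `nearer`; significant tips all have the same gap from
  -- the root, so the side determines them.
  separated : ∀ s {u v u′ v′} → Child s u v → Child s u′ v′ → Significant certified s u v →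
      Significant certified s u′ v′ →
              key s v ≡ key s v′ → v ≡ v′ ⊎ d s v ℕ.≤ d s u′ ⊎ d s v′ ℕ.≤ d s u
  separated s {u} {v} {u′} {v′} c c′ sig sig′ eq with Fin.combine-injective (kind v) _ (kind v′) _ eq
  separated s {v = spine i} {v′ = spine j} c c′ sig sig′ eq | _ , side≡
    with ℕ.<-cmp (gap (position s) i) (gap (position s) j)
  ... | tri< lt _ _  = inj₂ (inj₁ (nearer s {i} {j} lt c′))
  ... | tri≈ _ gap≡ _ = inj₁ (cong spine (same-side (position s) side≡ gap≡))
  ... | tri> _ _ gt  = inj₂ (inj₂ (nearer s {j} {i} gt c))
  separated s {v = tip i} {v′ = tip j} c c′ sig sig′ eq | _ , side≡ =
    inj₁ (cong tip (same-side (position s) side≡ (trans (significant-tip s c sig) (sym (significant-tip s c′ sig′)))))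

  cut-size-≤4 : ∀ {k} → CutSize graph k → k ℕ.≤ 4
  cut-size-≤4 = cut-bound certified key separated

  κ-exists : ¬ ¬ ∃ (κ graph)
  κ-exists = ¬¬greatest 4 cut-size-≤4 (spine zero , 0ℚ , ℚ.≤-refl , RootedTree.root-cut certified (spine zero))

  -- The highway dimensions of the comb.

  left right : Fin n → Fin N
  left i  = i Fin.↑ˡ n
  right i = n Fin.↑ʳ i

  left-right : ∀ i → gap (left i) (right i) ≡ n
  left-right i rewrite Fin.toℕ-↑ˡ i n | Fin.toℕ-↑ʳ n i | ℕ.+-comm n (toℕ i) = ℕ.∣m-m+n∣≡n (toℕ i) n

  rungPath : ∀ i → Path (tip (left i)) (tip (right i))
  rungPath i = left-right i ∷ []

  rungPath-length : ∀ i → ∥ rungPath i ∥ ≡ ι rung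
  rungPath-length i = ℚ.+-identityʳ (ι rung)

  rungPath-shortest : ∀ i → IsShortest (rungPath i)
  rungPath-shortest i =
      tight⇒shortest (rungPath i) (trans (rungPath-length i) (cong ι (sym (trans (cong tips (left-right i)) tips-n))))

  -- The position modulo `n`. Both ends of a rung get its number, so no node lies on two rungs.
  rungNumber : V → Fin n
  rungNumber v = [ id , id ]′ (Fin.splitAt n (position v))

  rungNumber-rungPath : ∀ {i x} → x ∈ nodes (rungPath i) → rungNumber x ≡ i
  rungNumber-rungPath {i} (here refl)         = cong [ id , id ]′ (Fin.splitAt-↑ˡ n i n)
  rungNumber-rungPath {i} (there (here refl)) = cong [ id , id ]′ (Fin.splitAt-↑ʳ n n i)

  -- As the rungs are disjoint, the index in `S` of the node that hits a rung determines the rung.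
  hitting-≥n : ∀ {S} → (∀ i → Hits graph S (rungPath i)) → n ℕ.≤ List.length S
  hitting-≥n {S} hits = Fin.injective⇒≤ {f = λ i → Any.index (proj₁ (proj₂ (hits i)))} λ {i} {j} eq →
    trans (sym (number i)) (trans (cong (rungNumber ∘ List.lookup S) eq) (number j))
    where
    number : ∀ i → rungNumber (List.lookup S (Any.index (proj₁ (proj₂ (hits i))))) ≡ i
    number i with hits i
    ... | x , x∈S , x∈π = trans (cong rungNumber (sym (Any.lookup-index x∈S))) (rungNumber-rungPath x∈π)

  -- One less than the length of a rung, so that rungs count as long, and half of `4N + 4`, so that
  -- the balls of radius `2r` and `4r` contain every node.
  radius : ℕ
  radius = 4 ℕ.* n ℕ.+ 2

  gap-≤ : ∀ (i j : Fin N) → gap i j ℕ.≤ N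
  gap-≤ i j = ℕ.≤-trans (ℕ.∣m-n∣≤m⊔n (toℕ i) (toℕ j)) (ℕ.⊔-lub (ℕ.<⇒≤ (Fin.toℕ<n i)) (ℕ.<⇒≤ (Fin.toℕ<n j)))

  d-≤-gap : ∀ u v → d u v ℕ.≤ 4 ℕ.* gap (position u) (position v) ℕ.+ 4
  d-≤-gap (spine i) (spine j) = ℕ.m≤m+n _ 4
  d-≤-gap (spine i) (tip j)   = ℕ.+-monoʳ-≤ (4 ℕ.* gap i j) (ℕ.m≤m+n 2 2)
  d-≤-gap (tip i)   (spine j) = ℕ.+-monoʳ-≤ (4 ℕ.* gap i j) (ℕ.m≤m+n 2 2)
  d-≤-gap (tip i)   (tip j)   = tips-≤ (gap i j)

  diameter : ∀ u v → d u v ℕ.≤ radius ℕ.+ radius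
  diameter u v = ℕ.≤-trans (d-≤-gap u v) (subst (4 ℕ.* gap (position u) (position v) ℕ.+ 4 ℕ.≤_) (ring n)
      (ℕ.+-monoˡ-≤ 4 (ℕ.*-monoʳ-≤ 4 (gap-≤ (position u) (position v)))))
    where
    ring : ∀ n → 4 ℕ.* (n ℕ.+ n) ℕ.+ 4 ≡ (4 ℕ.* n ℕ.+ 2) ℕ.+ (4 ℕ.* n ℕ.+ 2)
    ring = ℕ-Solver.solve-∀

  2·radius : + 2 ℚ./ 1 ℚ.* ι radius ≡ ι (radius ℕ.+ radius)
  2·radius = trans (ring (ι radius)) (sym (ι-+ radius radius))
    where
    ring : ∀ x → + 2 ℚ./ 1 ℚ.* x ≡ x ℚ.+ x
    ring = solve-∀ ℚ-ring

  4·radius : + 4 ℚ./ 1 ℚ.* ι radius ≡ ι ((radius ℕ.+ radius) ℕ.+ (radius ℕ.+ radius))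
  4·radius = trans (ring (ι radius)) (trans (sym (cong₂ ℚ._+_ (ι-+ radius radius) (ι-+ radius radius)))
      (sym (ι-+ (radius ℕ.+ radius) (radius ℕ.+ radius))))
    where
    ring : ∀ x → + 4 ℚ./ 1 ℚ.* x ≡ (x ℚ.+ x) ℚ.+ (x ℚ.+ x)
    ring = solve-∀ ℚ-ring

  inBall₂ : ∀ u v → InBall (+ 2 ℚ./ 1 ℚ.* ι radius) u v
  inBall₂ u v = inBall (subst (D u v ℚ.≤_) (sym 2·radius) (ι-mono-≤ (diameter u v)))

  inBall₄ : ∀ u v → InBall (+ 4 ℚ./ 1 ℚ.* ι radius) u v
  inBall₄ u v = inBall (subst (D u v ℚ.≤_) (sym 4·radius) (ι-mono-≤ (ℕ.≤-trans (diameter u v) (ℕ.m≤m+n _ _))))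

  0<radius : 0ℚ ℚ.< ι radius
  0<radius = subst (ℚ._< ι radius) ι-0 (ι-mono-< ℕ.z<s)

  long : ∀ i → ι radius ℚ.< ∥ rungPath i ∥
  long i = subst (ι radius ℚ.<_) (sym (rungPath-length i)) (ι-mono-< (ℕ.+-monoʳ-< (4 ℕ.* n) (ℕ.n<1+n 2)))

  not-too-long : ∀ i → ∥ rungPath i ∥ ℚ.≤ + 2 ℚ./ 1 ℚ.* ι radius
  not-too-long i = subst₂ ℚ._≤_ (sym (rungPath-length i)) (sym 2·radius)
    (ι-mono-≤ (ℕ.≤-trans (ℕ.≤-reflexive (ℕ.+-suc (4 ℕ.* n) 2))
        (ℕ.≤-trans (ℕ.≤-reflexive (ℕ.+-comm 1 radius)) (ℕ.+-monoʳ-≤ radius (ℕ.s≤s ℕ.z≤n)))))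

  HD₁-≥n : ∀ {k} → HD₁ graph k → n ℕ.≤ k
  HD₁-≥n hd with hd (ι radius) 0<radius (spine zero)
  ... | S , _ , size , hits = ℕ.≤-trans (hitting-≥n λ i → hits (rungPath i) (rungPath-shortest i) (long i)
      (All.universal (inBall₄ (spine zero)) _)) size

  HD₂-≥n : ∀ {k} → HD₂ graph k → n ℕ.≤ k
  HD₂-≥n hd with hd (ι radius) 0<radius (spine zero)
  ... | S , size , hits = ℕ.≤-trans (hitting-≥n λ i → hits (rungPath i) (rungPath-shortest i) (long i)
      (not-too-long i) (here (inBall₂ (spine zero) _))) size

-- The two families combined.

corollary21 : Incomparable hd₁ κ × Incomparable hd₂ κ
corollary21 =
    ( unbounded comb 4 (λ n → ¬¬least (Comb′.HD₁-exists n)) Comb.κ-exists hd₁-comb κ-comb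
    , unbounded star 1 UnitStar.κ-exists (λ n → ¬¬least (UnitStar.HD₁≤1 n)) κ-star
        (λ n h → proj₂ h 1 (UnitStar.HD₁≤1 n)) )
  , ( unbounded comb 4 (λ n → ¬¬least (Comb′.HD₂-exists n)) Comb.κ-exists hd₂-comb κ-comb
    , unbounded star 1 UnitStar.κ-exists (λ n → ¬¬least (UnitStar.HD₂≤1 n)) κ-star
        (λ n h → proj₂ h 1 (UnitStar.HD₂≤1 n)) )
  where
  module Comb′ n = Certified (Comb.certified n)

  comb star : ℕ → Graph
  comb n = Comb′.graph n
  star n = Certified.graph (UnitStar.certified n)

  hd₁-comb : ∀ n {k} → hd₁ (comb n) k → n ℕ.≤ k
  -- The comb with parameter `n` has `n + 1` rungs, so the inequality obtained is strict.
  hd₁-comb n h = ℕ.<⇒≤ (Comb.HD₁-≥n n (proj₁ h))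

  hd₂-comb : ∀ n {k} → hd₂ (comb n) k → n ℕ.≤ k
  hd₂-comb n h = ℕ.<⇒≤ (Comb.HD₂-≥n n (proj₁ h))

  κ-comb : ∀ n {k} → κ (comb n) k → k ℕ.≤ 4
  κ-comb n h = Comb.cut-size-≤4 n (proj₁ h)

  κ-star : ∀ n {k} → κ (star n) k → n ℕ.≤ k
  κ-star n h = proj₂ h n (UnitStar.cut-size n)
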